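{- Let $\tau,\sigma$ be finite types such that $\tau$ has type level $0$ or $1$ ($\sigma$ is arbitrary), and let $t\colon (\mathbb N\to\tau)\to\mathbb N$ be a closed term of system $\mathsf T$. Then the functional $\lambda G,H,s.\,\mathsf{BR}^{\tau,\sigma}(G,H,t)(s)$ is $\mathsf T$-definable, uniformly in $G$ and $H$. That is, there is a closed term $\xi\colon(\tau^*\to\sigma)\to(\tau^*\to(\tau\to\sigma)\to\sigma)\to\tau^*\to\sigma$ of system $\mathsf T$ such that for all $G\colon\tau^*\to\sigma$, all $H\colon\tau^*\to(\tau\to\sigma)\to\sigma$ (not required to be $\mathsf T$-definable) and all $s\colon\tau^*$: $$t(\hat s)<|s|\ \to\ \xi(G,H)(s)=G(s),\qquad t(\hat s)\ge|s|\ \to\ \xi(G,H)(s)=H(s)(\lambda x^\tau.\,\xi(G,H)(s*x)).$$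
   Context: Finite types: $\mathbb N$ is a finite type, and if $\tau_0,\tau_1$ are finite types then so are $\tau_0\to\tau_1$ (also written $\tau_1^{\tau_0}$) and $\tau_0^*$ (finite sequences of elements of type $\tau_0$); finite products $\tau\times\sigma$ are used as a definitional extension. Type levels: $\mathrm{level}(\mathbb N)=0$, $\mathrm{level}(\rho\to\eta)=\max\{\mathrm{level}(\rho)+1,\mathrm{level}(\eta)\}$, $\mathrm{level}(\tau\times\sigma)=\max\{\mathrm{level}(\tau),\mathrm{level}(\sigma)\}$, $\mathrm{level}(\tau^*)=\mathrm{level}(\tau)$. System $\mathsf T$ is the simply typed $\lambda$-calculus over these types with $0$, $\mathsf{Succ}$ and, for every finite type $\rho$, a recursor $\mathsf{Rec}^\rho$ with $\mathsf{Rec}^\rho(a,f)(0)=a$ and $\mathsf{Rec}^\rho(a,f)(\mathsf{Succ}(m))=f(m,\mathsf{Rec}^\rho(a,f)(m))$, where $a\colon\rho$, $f\colon\mathbb N\to\rho\to\rho$. Notation: $|s|$ is the length of $s\colon\tau^*$; $s*x$ is $s$ with $x\colon\tau$ appended; $0^\tau$ is the standard inductively defined zero object of type $\tau$; $\hat s\colon\mathbb N\to\tau$ is the extension of $s$ by infinitely many $0^\tau$. Spector's bar recursion $\mathsf{BR}^{\tau,\sigma}(G,H,Y)(s)$, for $G\colon\tau^*\to\sigma$, $H\colon\tau^*\to(\tau\to\sigma)\to\sigma$, $Y\colon(\mathbb N\to\tau)\to\mathbb N$, $s\colon\tau^*$, is the functional of type $\sigma$ satisfying $\mathsf{BR}(G,H,Y)(s)=G(s)$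 if $Y(\hat s)<|s|$, and $\mathsf{BR}(G,H,Y)(s)=H(s)(\lambda x^\tau.\mathsf{BR}(G,H,Y)(s*x))$ otherwise. The verification is understood to take place in $\mathbf{HA}^\omega$, intuitionistic Heyting arithmetic in all finite types. -}

module Defs where

open import Data.List.Base using (List; []; _∷_; map)
open import Data.List.Membership.Propositional using (_∈_)
open import Data.Nat.Base using (ℕ; zero; suc; _⊔_)

infixr 25 _⇒_
infixr 26 _⊗_
infix  30 _*
infix  4  _∋_
infixl 20 _·_
infix  15 _≐_ _≺_ _≼_
infixr 14 _∧_
infixr 13 _∨_
infixr 12 _⊃_
infix  4  _∣_⊢_

data Ty : Set where
  N   : Ty
  _⇒_ : Ty → Ty → Ty
  _⊗_ : Ty → Ty → Ty
  _*  : Ty → Ty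

level : Ty → ℕ
level N       = 0
level (ρ ⇒ η) = suc (level ρ) ⊔ level η
level (ρ ⊗ η) = level ρ ⊔ level η
level (ρ *)   = level ρ

Cx : Set
Cx = List Ty

private variable
  Γ Δ   : Cx
  ρ η τ : Ty

data _∋_ : Cx → Ty → Set where
  Z : ρ ∷ Γ ∋ ρ
  S : Γ ∋ ρ → η ∷ Γ ∋ ρ

-- System T.  Finite sequences are generated by the empty sequence and
-- appending on the right, s * x = Snoc · s · x, and come with the
-- corresponding primitive recursor SRec (interdefinable with length and
-- indexing by means of Rec).
data Tm (Γ : Cx) : Ty → Set where
  var  : Γ ∋ ρ → Tm Γ ρ
  lam  : Tm (ρ ∷ Γ) η → Tm Γ (ρ ⇒ η)
  _·_  : Tm Γ (ρ ⇒ η) → Tm Γ ρ → Tm Γ η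
  Zero : Tm Γ N
  Succ : Tm Γ (N ⇒ N)
  Rec  : Tm Γ (ρ ⇒ (N ⇒ ρ ⇒ ρ) ⇒ N ⇒ ρ)
  Pair : Tm Γ (ρ ⇒ η ⇒ ρ ⊗ η)
  Fst  : Tm Γ (ρ ⊗ η ⇒ ρ)
  Snd  : Tm Γ (ρ ⊗ η ⇒ η)
  Nil  : Tm Γ (ρ *)
  Snoc : Tm Γ (ρ * ⇒ ρ ⇒ ρ *)
  SRec : Tm Γ (η ⇒ (ρ * ⇒ ρ ⇒ η ⇒ η) ⇒ ρ * ⇒ η)

Ren : Cx → Cx → Set
Ren Γ Δ = ∀ {ρ} → Γ ∋ ρ → Δ ∋ ρ

Sub : Cx → Cx → Set
Sub Γ Δ = ∀ {ρ} → Γ ∋ ρ → Tm Δ ρ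

liftR : Ren Γ Δ → Ren (ρ ∷ Γ) (ρ ∷ Δ)
liftR r Z     = Z
liftR r (S x) = S (r x)

ren : Ren Γ Δ → Tm Γ ρ → Tm Δ ρ
ren r (var x) = var (r x)
ren r (lam t) = lam (ren (liftR r) t)
ren r (t · u) = ren r t · ren r u
ren r Zero    = Zero
ren r Succ    = Succ
ren r Rec     = Rec
ren r Pair    = Pair
ren r Fst     = Fst
ren r Snd     = Snd
ren r Nil     = Nil
ren r Snoc    = Snoc
ren r SRec    = SRec

wk : Tm Γ ρ → Tm (η ∷ Γ) ρ
wk = ren S

liftS : Sub Γ Δ → Sub (ρ ∷ Γ) (ρ ∷ Δ)
liftS s Z     = var Z
liftS s (S x) = wk (s x)

sub : Sub Γ Δ → Tm Γ ρ → Tm Δ ρ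
sub s (var x) = s x
sub s (lam t) = lam (sub (liftS s) t)
sub s (t · u) = sub s t · sub s u
sub s Zero    = Zero
sub s Succ    = Succ
sub s Rec     = Rec
sub s Pair    = Pair
sub s Fst     = Fst
sub s Snd     = Snd
sub s Nil     = Nil
sub s Snoc    = Snoc
sub s SRec    = SRec

inst : Tm Γ ρ → Sub (ρ ∷ Γ) Γ
inst u Z     = u
inst u (S x) = var x

closed : Tm [] ρ → Tm Γ ρ
closed = ren (λ ())

0ᵗ : (τ : Ty) → Tm Γ τ
0ᵗ N       = Zero
0ᵗ (ρ ⇒ η) = lam (0ᵗ η)
0ᵗ (ρ ⊗ η) = Pair · 0ᵗ ρ · 0ᵗ η
0ᵗ (ρ *)   = Nil

plus : Tm Γ (N ⇒ N ⇒ N)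
plus = lam (lam (Rec · var (S Z) · lam (lam (Succ · var Z)) · var Z))

-- dist · m · n = |m − n|, from the equations
-- d(0,n) = n,  d(Sm,0) = Sm,  d(Sm,Sn) = d(m,n).
dist : Tm Γ (N ⇒ N ⇒ N)
dist = Rec · lam (var Z)
           · lam (lam (lam (Rec · (Succ · var (S (S Z)))
                                · lam (lam (var (S (S (S Z))) · var (S Z)))
                                · var Z)))

-- cond · n · a · b is a if n = 0, and b otherwise.
cond : Tm Γ (N ⇒ ρ ⇒ ρ ⇒ ρ)
cond = lam (lam (lam (Rec · var (S Z) · lam (lam (var (S (S Z)))) · var (S (S Z)))))

len : Tm Γ (τ * ⇒ N)
len = SRec · Zero · lam (lam (lam (Succ · var Z)))

-- ŝ, by recursion on s:  the extension of ⟨⟩ is constantly 0, and that of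
-- s * x at i is x if i = |s|, and ŝ(i) otherwise.
hat : Tm Γ (τ * ⇒ N ⇒ τ)
hat {τ = τ} =
  SRec · lam (0ᵗ τ)
       · lam (lam (lam (lam
           (cond · (dist · var Z · (len · var (S (S (S Z)))))
                 · var (S (S Z))
                 · (var (S Z) · var Z)))))

data Fm (Γ : Cx) : Set where
  _≐_         : Tm Γ ρ → Tm Γ ρ → Fm Γ
  ⊥           : Fm Γ
  _∧_ _∨_ _⊃_ : Fm Γ → Fm Γ → Fm Γ
  all ex      : (ρ : Ty) → Fm (ρ ∷ Γ) → Fm Γ

subF : Sub Γ Δ → Fm Γ → Fm Δ
subF s (t ≐ u)   = sub s t ≐ sub s u
subF s ⊥         = ⊥
subF s (φ ∧ ψ)   = subF s φ ∧ subF s ψ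
subF s (φ ∨ ψ)   = subF s φ ∨ subF s ψ
subF s (φ ⊃ ψ)   = subF s φ ⊃ subF s ψ
subF s (all ρ φ) = all ρ (subF (liftS s) φ)
subF s (ex ρ φ)  = ex ρ (subF (liftS s) φ)

wkF : Fm Γ → Fm (ρ ∷ Γ)
wkF = subF (λ x → var (S x))

_[_] : Fm (ρ ∷ Γ) → Tm Γ ρ → Fm Γ
φ [ t ] = subF (inst t) φ

succS : Sub (N ∷ Γ) (N ∷ Γ)
succS Z     = Succ · var Z
succS (S x) = var (S x)

-- In the context ρ ∷ ρ * ∷ Γ, oldS leaves the sequence variable s unchanged
-- and snocS replaces it by s * x.
oldS snocS : Sub (ρ * ∷ Γ) (ρ ∷ ρ * ∷ Γ)
oldS x      = var (S x)
snocS Z     = Snoc · var (S Z) · var Z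
snocS (S x) = var (S (S x))

-- Natural deduction for HA^ω, with equality at all types and extensionality
-- (without which the bar recursion equation, whose right-hand side applies
-- an arbitrary H to a λ-abstraction, cannot be verified by replacing
-- provably equal terms under λ).
data _∣_⊢_ (Γ : Cx) (Θ : List (Fm Γ)) : Fm Γ → Set where
  hyp  : ∀ {φ} → φ ∈ Θ → Γ ∣ Θ ⊢ φ
  ⊥E   : ∀ {φ} → Γ ∣ Θ ⊢ ⊥ → Γ ∣ Θ ⊢ φ
  ∧I   : ∀ {φ ψ} → Γ ∣ Θ ⊢ φ → Γ ∣ Θ ⊢ ψ → Γ ∣ Θ ⊢ φ ∧ ψ
  ∧E₁  : ∀ {φ ψ} → Γ ∣ Θ ⊢ φ ∧ ψ → Γ ∣ Θ ⊢ φ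
  ∧E₂  : ∀ {φ ψ} → Γ ∣ Θ ⊢ φ ∧ ψ → Γ ∣ Θ ⊢ ψ
  ∨I₁  : ∀ {φ ψ} → Γ ∣ Θ ⊢ φ → Γ ∣ Θ ⊢ φ ∨ ψ
  ∨I₂  : ∀ {φ ψ} → Γ ∣ Θ ⊢ ψ → Γ ∣ Θ ⊢ φ ∨ ψ
  ∨E   : ∀ {φ ψ χ} → Γ ∣ Θ ⊢ φ ∨ ψ →
         Γ ∣ φ ∷ Θ ⊢ χ → Γ ∣ ψ ∷ Θ ⊢ χ → Γ ∣ Θ ⊢ χ
  ⊃I   : ∀ {φ ψ} → Γ ∣ φ ∷ Θ ⊢ ψ → Γ ∣ Θ ⊢ φ ⊃ ψ
  ⊃E   : ∀ {φ ψ} → Γ ∣ Θ ⊢ φ ⊃ ψ → Γ ∣ Θ ⊢ φ → Γ ∣ Θ ⊢ ψ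
  ∀I   : ∀ {φ} → ρ ∷ Γ ∣ map wkF Θ ⊢ φ → Γ ∣ Θ ⊢ all ρ φ
  ∀E   : ∀ {φ} → Γ ∣ Θ ⊢ all ρ φ → (t : Tm Γ ρ) → Γ ∣ Θ ⊢ φ [ t ]
  ∃I   : ∀ {φ} (t : Tm Γ ρ) → Γ ∣ Θ ⊢ φ [ t ] → Γ ∣ Θ ⊢ ex ρ φ
  ∃E   : ∀ {φ ψ} → Γ ∣ Θ ⊢ ex ρ φ →
         ρ ∷ Γ ∣ φ ∷ map wkF Θ ⊢ wkF ψ → Γ ∣ Θ ⊢ ψ

  ≐refl : {t : Tm Γ ρ} → Γ ∣ Θ ⊢ t ≐ t
  ≐repl : {t u : Tm Γ ρ} (φ : Fm (ρ ∷ Γ)) →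
          Γ ∣ Θ ⊢ t ≐ u → Γ ∣ Θ ⊢ φ [ t ] → Γ ∣ Θ ⊢ φ [ u ]
  ext   : {f g : Tm Γ (ρ ⇒ η)} →
          Γ ∣ Θ ⊢ all ρ (wk f · var Z ≐ wk g · var Z) → Γ ∣ Θ ⊢ f ≐ g

  β     : (t : Tm (ρ ∷ Γ) η) (u : Tm Γ ρ) →
          Γ ∣ Θ ⊢ lam t · u ≐ sub (inst u) t
  rec0  : (a : Tm Γ ρ) (f : Tm Γ (N ⇒ ρ ⇒ ρ)) →
          Γ ∣ Θ ⊢ Rec · a · f · Zero ≐ a
  recS  : (a : Tm Γ ρ) (f : Tm Γ (N ⇒ ρ ⇒ ρ)) (m : Tm Γ N) →
          Γ ∣ Θ ⊢ Rec · a · f · (Succ · m) ≐ f · m · (Rec · a · f · m)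
  srec0 : (a : Tm Γ η) (f : Tm Γ (ρ * ⇒ ρ ⇒ η ⇒ η)) →
          Γ ∣ Θ ⊢ SRec · a · f · Nil ≐ a
  srecS : (a : Tm Γ η) (f : Tm Γ (ρ * ⇒ ρ ⇒ η ⇒ η)) (s : Tm Γ (ρ *)) (x : Tm Γ ρ) →
          Γ ∣ Θ ⊢ SRec · a · f · (Snoc · s · x) ≐ f · s · x · (SRec · a · f · s)
  fst   : (a : Tm Γ ρ) (b : Tm Γ η) → Γ ∣ Θ ⊢ Fst · (Pair · a · b) ≐ a
  snd   : (a : Tm Γ ρ) (b : Tm Γ η) → Γ ∣ Θ ⊢ Snd · (Pair · a · b) ≐ b
  pair  : (p : Tm Γ (ρ ⊗ η)) → Γ ∣ Θ ⊢ Pair · (Fst · p) · (Snd · p) ≐ p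

  succ≠0  : (m : Tm Γ N) → Γ ∣ Θ ⊢ Succ · m ≐ Zero ⊃ ⊥
  succInj : (m n : Tm Γ N) → Γ ∣ Θ ⊢ Succ · m ≐ Succ · n ⊃ m ≐ n
  ind     : (φ : Fm (N ∷ Γ)) → Γ ∣ Θ ⊢ φ [ Zero ] →
            Γ ∣ Θ ⊢ all N (φ ⊃ subF succS φ) → Γ ∣ Θ ⊢ all N φ
  sind    : (φ : Fm (ρ * ∷ Γ)) → Γ ∣ Θ ⊢ φ [ Nil ] →
            Γ ∣ Θ ⊢ all (ρ *) (all ρ (subF oldS φ ⊃ subF snocS φ)) →
            Γ ∣ Θ ⊢ all (ρ *) φ

HAω⊢_ : Fm [] → Set
HAω⊢ φ = [] ∣ [] ⊢ φ
infix 4 HAω⊢_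

_≼_ _≺_ : Tm Γ N → Tm Γ N → Fm Γ
m ≼ n = ex N (plus · wk m · var Z ≐ wk n)
m ≺ n = Succ · m ≼ n

-- The types of G, H and of λ G H s. BR(G,H,Y)(s), for fixed Y.
Gᵗ Hᵗ BRᵗ : Ty → Ty → Ty
Gᵗ  τ σ = τ * ⇒ σ
Hᵗ  τ σ = τ * ⇒ (τ ⇒ σ) ⇒ σ
BRᵗ τ σ = Gᵗ τ σ ⇒ Hᵗ τ σ ⇒ τ * ⇒ σ

-- ∀ G H s. (Y(ŝ) < |s| → ξ(G,H)(s) = G(s))
--        ∧ (|s| ≤ Y(ŝ) → ξ(G,H)(s) = H(s)(λx. ξ(G,H)(s * x)))
SpectorBR : (τ σ : Ty) → Tm [] ((N ⇒ τ) ⇒ N) → Tm [] (BRᵗ τ σ) → Fm []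
SpectorBR τ σ Y ξ =
  all (Gᵗ τ σ) (all (Hᵗ τ σ) (all (τ *)
    (  (Yŝ ≺ len · s ⊃ closed ξ · G · H · s ≐ G · s)
     ∧ (len · s ≼ Yŝ ⊃ closed ξ · G · H · s
          ≐ H · s · lam (closed ξ · wk G · wk H · (Snoc · wk s · var Z))))))
  where
  Γ₃ : Cx
  Γ₃ = τ * ∷ Hᵗ τ σ ∷ Gᵗ τ σ ∷ []
  G : Tm Γ₃ (Gᵗ τ σ)
  G = var (S (S Z))
  H : Tm Γ₃ (Hᵗ τ σ)
  H = var (S Z)
  s : Tm Γ₃ (τ *)
  s = var Z
  Yŝ : Tm Γ₃ N
  Yŝ = closed Y · (hat · s)

{-# OPTIONS --safe #-}
module Submission where

-- The term t is translated in continuation-passing style with answer type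
-- R = τ* → σ: a number becomes a functional (ℕ → R) → R, and all other types
-- but sequences are translated pointwise.  The argument of t is replaced by a
-- generic sequence, which answers the query for entry n by prolonging the
-- given s until it has that entry, a primitive recursion on (n + 1) ∸ |s|.
--
-- Bar recursion for t is the fixed point of Φ(B)(s) = G(s) if t(ŝ) < |s|, and
-- H(s)(λx. B(s * x)) otherwise.  A logical relation between a translated number
-- d and a number y(s) depending on s says: if the candidates C(n) satisfy the
-- fixed point equation wherever y is constantly n on all extensions, then d(C)
-- satisfies it everywhere.  For d the translation of t this yields the theorem,
-- with C(n) prolonging s until |s| > n: there t(ŝ) = n < |s|.  Recursion on a
-- translated number or sequence extends a function on plain values to
-- continuations, by recursion on the type of its values.  A τ of level at most
-- 1 is needed to embed the entries of a sequence into the translated type.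
--
-- To relate closed terms only, t is first rewritten as a combinatory term.

open import Defs
open import Data.List.Base using ([])
open import Data.Nat.Base using (_≤_)
open import Data.Product using (∃-syntax)
open import Data.List.Base using (List; _∷_; map; _++_)
open import Data.List.Membership.Propositional using (_∈_)
open import Data.List.Relation.Unary.Any using (here; there)
open import Data.Maybe.Base using (Maybe; just; nothing)
open import Data.Nat.Base using (ℕ; zero; suc; s≤s⁻¹)
open import Data.Nat.Properties using (≤-trans; m≤m⊔n; m≤n⊔m)
open import Data.Product.Base using (Σ; _,_; proj₁; proj₂)
open import Data.Sum.Base using (_⊎_; inj₁; inj₂)
open import Relation.Binary.PropositionalEquality using (_≡_; refl; sym; trans; cong; cong₂; subst; subst₂)
open import Relation.Nullary.Negation using (contradiction)

infixl 20 _·_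
infix  15 _≐_
infixr 14 _∧_
infixr 12 _⊃_
infixl 5  _▸_
infix  4  _∣_⊩_ _∣_⊨_

private variable
  Γ Δ Ξ : Cx
  ρ η θ : Ty

-- Substitution calculus of Defs

liftS-cong : {s s' : Sub Γ Δ} → (∀ {ρ} (x : Γ ∋ ρ) → s x ≡ s' x) →
             ∀ {ρ} (x : η ∷ Γ ∋ ρ) → liftS s x ≡ liftS s' x
liftS-cong e Z     = refl
liftS-cong e (S x) = cong wk (e x)

sub-cong : {s s' : Sub Γ Δ} → (∀ {ρ} (x : Γ ∋ ρ) → s x ≡ s' x) →
           (t : Tm Γ ρ) → sub s t ≡ sub s' t
sub-cong e (var x) = e x
sub-cong e (lam t) = cong lam (sub-cong (liftS-cong e) t)
sub-cong e (t · u) = cong₂ _·_ (sub-cong e t) (sub-cong e u)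
sub-cong e Zero    = refl
sub-cong e Succ    = refl
sub-cong e Rec     = refl
sub-cong e Pair    = refl
sub-cong e Fst     = refl
sub-cong e Snd     = refl
sub-cong e Nil     = refl
sub-cong e Snoc    = refl
sub-cong e SRec    = refl

sub-id : {s : Sub Γ Γ} → (∀ {ρ} (x : Γ ∋ ρ) → s x ≡ var x) → (t : Tm Γ ρ) → sub s t ≡ t
sub-id e (var x) = e x
sub-id e (lam t) = cong lam (sub-id (λ { Z → refl ; (S x) → cong wk (e x) }) t)
sub-id e (t · u) = cong₂ _·_ (sub-id e t) (sub-id e u)
sub-id e Zero    = refl
sub-id e Succ    = refl
sub-id e Rec     = refl
sub-id e Pair    = refl
sub-id e Fst     = refl
sub-id e Snd     = refl
sub-id e Nil     = refl
sub-id e Snoc    = refl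
sub-id e SRec    = refl

ren-ren : {q : Ren Γ Δ} {r : Ren Δ Ξ} {p : Ren Γ Ξ} → (∀ {ρ} (x : Γ ∋ ρ) → r (q x) ≡ p x) →
          (t : Tm Γ ρ) → ren r (ren q t) ≡ ren p t
ren-ren e (var x) = cong var (e x)
ren-ren e (lam t) = cong lam (ren-ren (λ { Z → refl ; (S x) → cong S (e x) }) t)
ren-ren e (t · u) = cong₂ _·_ (ren-ren e t) (ren-ren e u)
ren-ren e Zero    = refl
ren-ren e Succ    = refl
ren-ren e Rec     = refl
ren-ren e Pair    = refl
ren-ren e Fst     = refl
ren-ren e Snd     = refl
ren-ren e Nil     = refl
ren-ren e Snoc    = refl
ren-ren e SRec    = refl

sub-ren : {r : Ren Γ Δ} {s : Sub Δ Ξ} {p : Sub Γ Ξ} → (∀ {ρ} (x : Γ ∋ ρ) → s (r x) ≡ p x) →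
          (t : Tm Γ ρ) → sub s (ren r t) ≡ sub p t
sub-ren e (var x) = e x
sub-ren e (lam t) = cong lam (sub-ren (λ { Z → refl ; (S x) → cong wk (e x) }) t)
sub-ren e (t · u) = cong₂ _·_ (sub-ren e t) (sub-ren e u)
sub-ren e Zero    = refl
sub-ren e Succ    = refl
sub-ren e Rec     = refl
sub-ren e Pair    = refl
sub-ren e Fst     = refl
sub-ren e Snd     = refl
sub-ren e Nil     = refl
sub-ren e Snoc    = refl
sub-ren e SRec    = refl

ren-wk : (r : Ren Γ Δ) (t : Tm Γ ρ) → ren (liftR {ρ = η} r) (wk t) ≡ wk (ren r t)
ren-wk r t = trans (ren-ren (λ _ → refl) t) (sym (ren-ren (λ _ → refl) t))

ren-sub : {s : Sub Γ Δ} {r : Ren Δ Ξ} {p : Sub Γ Ξ} → (∀ {ρ} (x : Γ ∋ ρ) → ren r (s x) ≡ p x) →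
          (t : Tm Γ ρ) → ren r (sub s t) ≡ sub p t
ren-sub e (var x) = e x
ren-sub {s = s} {r} e (lam t) =
  cong lam (ren-sub (λ { Z → refl ; (S x) → trans (ren-wk r (s x)) (cong wk (e x)) }) t)
ren-sub e (t · u) = cong₂ _·_ (ren-sub e t) (ren-sub e u)
ren-sub e Zero    = refl
ren-sub e Succ    = refl
ren-sub e Rec     = refl
ren-sub e Pair    = refl
ren-sub e Fst     = refl
ren-sub e Snd     = refl
ren-sub e Nil     = refl
ren-sub e Snoc    = refl
ren-sub e SRec    = refl

sub-wk : (s : Sub Γ Δ) (t : Tm Γ ρ) → sub (liftS {ρ = η} s) (wk t) ≡ wk (sub s t)
sub-wk s t = trans (sub-ren (λ _ → refl) t) (sym (ren-sub (λ _ → refl) t))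

liftS-fuse : {s : Sub Γ Δ} {s' : Sub Δ Ξ} {p : Sub Γ Ξ} → (∀ {ρ} (x : Γ ∋ ρ) → sub s' (s x) ≡ p x) →
             ∀ {ρ} (x : η ∷ Γ ∋ ρ) → sub (liftS s') (liftS s x) ≡ liftS p x
liftS-fuse                  e Z     = refl
liftS-fuse {s = s} {s' = s'} e (S x) = trans (sub-wk s' (s x)) (cong wk (e x))

sub-sub : {s : Sub Γ Δ} {s' : Sub Δ Ξ} {p : Sub Γ Ξ} → (∀ {ρ} (x : Γ ∋ ρ) → sub s' (s x) ≡ p x) →
          (t : Tm Γ ρ) → sub s' (sub s t) ≡ sub p t
sub-sub e (var x) = e x
sub-sub e (lam t) = cong lam (sub-sub (liftS-fuse e) t)
sub-sub e (t · u) = cong₂ _·_ (sub-sub e t) (sub-sub e u)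
sub-sub e Zero    = refl
sub-sub e Succ    = refl
sub-sub e Rec     = refl
sub-sub e Pair    = refl
sub-sub e Fst     = refl
sub-sub e Snd     = refl
sub-sub e Nil     = refl
sub-sub e Snoc    = refl
sub-sub e SRec    = refl

ren-as-sub : (r : Ren Γ Δ) (t : Tm Γ ρ) → ren r t ≡ sub (λ x → var (r x)) t
ren-as-sub r t = trans (cong (ren r) (sym (sub-id (λ _ → refl) t))) (ren-sub (λ _ → refl) t)

inst-wk : (u : Tm Γ η) (t : Tm Γ ρ) → sub (inst u) (wk t) ≡ t
inst-wk u t = trans (sub-ren (λ _ → refl) t) (sub-id (λ _ → refl) t)

inst-var : (t : Tm (η ∷ Γ) ρ) → sub (inst (var Z)) (ren (liftR S) t) ≡ t
inst-var t = trans (sub-ren (λ _ → refl) t) (sub-id (λ { Z → refl ; (S x) → refl }) t)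

ren-closed : (r : Ren Γ Δ) (t : Tm [] ρ) → ren r (closed t) ≡ closed t
ren-closed r t = ren-ren (λ ()) t

closed-id : (t : Tm [] ρ) → closed t ≡ t
closed-id t = trans (ren-as-sub _ t) (sub-id (λ ()) t)

sub-closed : (s : Sub Γ Δ) (t : Tm [] ρ) → sub s (closed t) ≡ closed t
sub-closed s t = trans (sub-ren {p = λ ()} (λ ()) t) (sym (trans (ren-as-sub _ t) (sub-cong (λ ()) t)))

subF-cong : {s s' : Sub Γ Δ} → (∀ {ρ} (x : Γ ∋ ρ) → s x ≡ s' x) → (φ : Fm Γ) → subF s φ ≡ subF s' φ
subF-cong e (t ≐ u)   = cong₂ _≐_ (sub-cong e t) (sub-cong e u)
subF-cong e ⊥         = refl
subF-cong e (φ ∧ ψ)   = cong₂ _∧_ (subF-cong e φ) (subF-cong e ψ)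
subF-cong e (φ ∨ ψ)   = cong₂ _∨_ (subF-cong e φ) (subF-cong e ψ)
subF-cong e (φ ⊃ ψ)   = cong₂ _⊃_ (subF-cong e φ) (subF-cong e ψ)
subF-cong e (all ρ φ) = cong (all ρ) (subF-cong (liftS-cong e) φ)
subF-cong e (ex ρ φ)  = cong (ex ρ) (subF-cong (liftS-cong e) φ)

subF-id : {s : Sub Γ Γ} → (∀ {ρ} (x : Γ ∋ ρ) → s x ≡ var x) → (φ : Fm Γ) → subF s φ ≡ φ
subF-id e (t ≐ u)   = cong₂ _≐_ (sub-id e t) (sub-id e u)
subF-id e ⊥         = refl
subF-id e (φ ∧ ψ)   = cong₂ _∧_ (subF-id e φ) (subF-id e ψ)
subF-id e (φ ∨ ψ)   = cong₂ _∨_ (subF-id e φ) (subF-id e ψ)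
subF-id e (φ ⊃ ψ)   = cong₂ _⊃_ (subF-id e φ) (subF-id e ψ)
subF-id e (all ρ φ) = cong (all ρ) (subF-id (λ { Z → refl ; (S x) → cong wk (e x) }) φ)
subF-id e (ex ρ φ)  = cong (ex ρ) (subF-id (λ { Z → refl ; (S x) → cong wk (e x) }) φ)

subF-subF : {s : Sub Γ Δ} {s' : Sub Δ Ξ} {p : Sub Γ Ξ} → (∀ {ρ} (x : Γ ∋ ρ) → sub s' (s x) ≡ p x) →
            (φ : Fm Γ) → subF s' (subF s φ) ≡ subF p φ
subF-subF e (t ≐ u)   = cong₂ _≐_ (sub-sub e t) (sub-sub e u)
subF-subF e ⊥         = refl
subF-subF e (φ ∧ ψ)   = cong₂ _∧_ (subF-subF e φ) (subF-subF e ψ)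
subF-subF e (φ ∨ ψ)   = cong₂ _∨_ (subF-subF e φ) (subF-subF e ψ)
subF-subF e (φ ⊃ ψ)   = cong₂ _⊃_ (subF-subF e φ) (subF-subF e ψ)
subF-subF e (all ρ φ) = cong (all ρ) (subF-subF (liftS-fuse e) φ)
subF-subF e (ex ρ φ)  = cong (ex ρ) (subF-subF (liftS-fuse e) φ)

-- Equational reasoning in HA^ω

private variable
  L : List (Fm Γ)

≐sym : {t u : Tm Γ ρ} → Γ ∣ L ⊢ t ≐ u → Γ ∣ L ⊢ u ≐ t
≐sym {Γ} {L = L} {t = t} {u} p =
  subst (λ v → Γ ∣ L ⊢ u ≐ v) (inst-wk u t)
    (≐repl (var Z ≐ wk t) p (subst (λ v → Γ ∣ L ⊢ t ≐ v) (sym (inst-wk t t)) ≐refl))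

≐trans : {t u v : Tm Γ ρ} → Γ ∣ L ⊢ t ≐ u → Γ ∣ L ⊢ u ≐ v → Γ ∣ L ⊢ t ≐ v
≐trans {Γ} {L = L} {t = t} {u} {v} p q =
  subst (λ w → Γ ∣ L ⊢ w ≐ v) (inst-wk v t)
    (≐repl (wk t ≐ var Z) q (subst (λ w → Γ ∣ L ⊢ w ≐ u) (sym (inst-wk u t)) p))

≐cong : {t u : Tm Γ η} (c : Tm (η ∷ Γ) ρ) → Γ ∣ L ⊢ t ≐ u → Γ ∣ L ⊢ sub (inst t) c ≐ sub (inst u) c
≐cong {Γ} {L = L} {t = t} {u} c p =
  subst (λ w → Γ ∣ L ⊢ w ≐ sub (inst u) c) (inst-wk u _)
    (≐repl (wk (sub (inst t) c) ≐ c) p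
      (subst (λ w → Γ ∣ L ⊢ w ≐ sub (inst t) c) (sym (inst-wk t _)) ≐refl))

≐ap : {f g : Tm Γ (ρ ⇒ η)} {t u : Tm Γ ρ} → Γ ∣ L ⊢ f ≐ g → Γ ∣ L ⊢ t ≐ u → Γ ∣ L ⊢ f · t ≐ g · u
≐ap {Γ} {L = L} {f = f} {g} {t} {u} p q = ≐trans
  (subst (λ w → Γ ∣ L ⊢ f · w ≐ g · w) (inst-wk g t)
    (subst (λ w → Γ ∣ L ⊢ f · w ≐ g · sub (inst g) (wk t)) (trans (inst-wk f t) (sym (inst-wk g t)))
      (≐cong (var Z · wk t) p)))
  (subst (λ w → Γ ∣ L ⊢ w · t ≐ w · u) (inst-wk u g)
    (subst (λ w → Γ ∣ L ⊢ w · t ≐ sub (inst u) (wk g) · u) (trans (inst-wk t g) (sym (inst-wk u g)))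
      (≐cong (wk g · var Z) q)))

≐ext : {f g : Tm Γ (ρ ⇒ η)} → ρ ∷ Γ ∣ map wkF L ⊢ wk f · var Z ≐ wk g · var Z → Γ ∣ L ⊢ f ≐ g
≐ext p = ext (∀I p)

β-var : {L : List (Fm (ρ ∷ Γ))} (t : Tm (ρ ∷ Γ) η) → ρ ∷ Γ ∣ L ⊢ wk (lam t) · var Z ≐ t
β-var {ρ} {Γ} {L = L} t = subst (λ w → ρ ∷ Γ ∣ L ⊢ wk (lam t) · var Z ≐ w) (inst-var t) (β _ _)

≐lam : {t u : Tm (ρ ∷ Γ) η} → ρ ∷ Γ ∣ map wkF L ⊢ t ≐ u → Γ ∣ L ⊢ lam t ≐ lam u
≐lam p = ≐ext (≐trans (β-var _) (≐trans p (≐sym (β-var _))))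

≐η : (t : Tm Γ (ρ ⇒ η)) → Γ ∣ L ⊢ lam (wk t · var Z) ≐ t
≐η t = ≐ext (β-var (wk t · var Z))

-- Terms and formulas on which substitution computes

data Const : Ty → Set where
  zero : Const N
  succ : Const (N ⇒ N)
  rec  : Const (ρ ⇒ (N ⇒ ρ ⇒ ρ) ⇒ N ⇒ ρ)
  pair : Const (ρ ⇒ η ⇒ ρ ⊗ η)
  fst  : Const (ρ ⊗ η ⇒ ρ)
  snd  : Const (ρ ⊗ η ⇒ η)
  nil  : Const (ρ *)
  snoc : Const (ρ * ⇒ ρ ⇒ ρ *)
  srec : Const (η ⇒ (ρ * ⇒ ρ ⇒ η ⇒ η) ⇒ ρ * ⇒ η)

infix 5 _‼_
_‼_ : Cx → ℕ → Maybe Ty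
[]      ‼ n     = nothing
(ρ ∷ Γ) ‼ zero  = just ρ
(ρ ∷ Γ) ‼ suc n = Γ ‼ n

record At (Γ : Cx) (n : ℕ) (ρ : Ty) : Set where
  constructor found
  field lookup : Γ ‼ n ≡ just ρ

-- con c stands for the closed term c and is, by definition, fixed by
-- substitution, also where c does not compute.  Variables are numbers, since
-- a proof of Γ ∋ ρ carries many copies of Γ.
data Exp (Γ : Cx) : Ty → Set where
  ix  : (n : ℕ) → At Γ n ρ → Exp Γ ρ
  lam : Exp (ρ ∷ Γ) η → Exp Γ (ρ ⇒ η)
  _·_ : Exp Γ (ρ ⇒ η) → Exp Γ ρ → Exp Γ η
  kon : Const ρ → Exp Γ ρ
  con : Tm [] ρ → Exp Γ ρ

pattern v₀ = ix 0 (found refl)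
pattern v₁ = ix 1 (found refl)
pattern v₂ = ix 2 (found refl)
pattern v₃ = ix 3 (found refl)
pattern v₄ = ix 4 (found refl)
pattern v₅ = ix 5 (found refl)
pattern v₆ = ix 6 (found refl)
pattern v₇ = ix 7 (found refl)
pattern v₈ = ix 8 (found refl)
pattern v₉ = ix 9 (found refl)
pattern v₁₀ = ix 10 (found refl)
pattern v₁₁ = ix 11 (found refl)

variable-at : (Γ : Cx) (n : ℕ) → At Γ n ρ → Γ ∋ ρ
variable-at (ρ ∷ Γ) zero    (found refl) = Z
variable-at (ρ ∷ Γ) (suc n) (found p) = S (variable-at Γ n (found p))

kon-tm : Const ρ → Tm Γ ρ
kon-tm zero = Zero
kon-tm succ = Succ
kon-tm rec  = Rec
kon-tm pair = Pair
kon-tm fst  = Fst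
kon-tm snd  = Snd
kon-tm nil  = Nil
kon-tm snoc = Snoc
kon-tm srec = SRec

tm : Exp Γ ρ → Tm Γ ρ
tm (ix n p) = var (variable-at _ n p)
tm (lam t)  = lam (tm t)
tm (t · u)  = tm t · tm u
tm (kon k)  = kon-tm k
tm (con c)  = closed c

RenE SubE : Cx → Cx → Set
RenE Γ Δ = ∀ {ρ} n → At Γ n ρ → Σ ℕ λ m → At Δ m ρ
SubE Γ Δ = ∀ {ρ} n → At Γ n ρ → Exp Δ ρ

liftʳ : RenE Γ Δ → RenE (ρ ∷ Γ) (ρ ∷ Δ)
liftʳ r zero    (found p) = zero , found p
liftʳ r (suc n) (found p) = suc (proj₁ (r n (found p))) , found (At.lookup (proj₂ (r n (found p))))

renₑ : RenE Γ Δ → Exp Γ ρ → Exp Δ ρ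
renₑ r (ix n p) = ix (proj₁ (r n p)) (proj₂ (r n p))
renₑ r (lam t)  = lam (renₑ (liftʳ r) t)
renₑ r (t · u)  = renₑ r t · renₑ r u
renₑ r (kon k)  = kon k
renₑ r (con c)  = con c

shift : RenE Γ (ρ ∷ Γ)
shift n (found p) = suc n , found p

closing : RenE [] Γ
closing n (found ())

weaken : SubE Γ (ρ ∷ Γ)
weaken n (found p) = ix (suc n) (found p)

liftₑ : SubE Γ Δ → SubE (ρ ∷ Γ) (ρ ∷ Δ)
liftₑ s zero    (found p) = ix zero (found p)
liftₑ s (suc n) (found p) = renₑ shift (s n (found p))

subₑ : SubE Γ Δ → Exp Γ ρ → Exp Δ ρ
subₑ s (ix n p) = s n p
subₑ s (lam t)  = lam (subₑ (liftₑ s) t)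
subₑ s (t · u)  = subₑ s t · subₑ s u
subₑ s (kon k)  = kon k
subₑ s (con c)  = con c

instₑ : Exp Γ ρ → SubE (ρ ∷ Γ) Γ
instₑ u zero    (found refl) = u
instₑ u (suc n) (found p)    = ix n (found p)

ren-kon : (r : Ren Γ Δ) (k : Const ρ) → ren r (kon-tm k) ≡ kon-tm k
ren-kon r zero = refl
ren-kon r succ = refl
ren-kon r rec  = refl
ren-kon r pair = refl
ren-kon r fst  = refl
ren-kon r snd  = refl
ren-kon r nil  = refl
ren-kon r snoc = refl
ren-kon r srec = refl

sub-kon : (s : Sub Γ Δ) (k : Const ρ) → sub s (kon-tm k) ≡ kon-tm k
sub-kon r zero = refl
sub-kon r succ = refl
sub-kon r rec  = refl
sub-kon r pair = refl
sub-kon r fst  = refl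
sub-kon r snd  = refl
sub-kon r nil  = refl
sub-kon r snoc = refl
sub-kon r srec = refl

private
  _matchesʳ_ : RenE Γ Δ → Ren Γ Δ → Set
  _matchesʳ_ {Γ} {Δ} r r' = ∀ {ρ} n (p : At Γ n ρ) →
    variable-at Δ (proj₁ (r n p)) (proj₂ (r n p)) ≡ r' (variable-at Γ n p)

  _matches_ : SubE Γ Δ → Sub Γ Δ → Set
  _matches_ {Γ} s s' = ∀ {ρ} n (p : At Γ n ρ) → tm (s n p) ≡ s' (variable-at Γ n p)

tm-ren : {r : RenE Γ Δ} {r' : Ren Γ Δ} → r matchesʳ r' → (t : Exp Γ ρ) → tm (renₑ r t) ≡ ren r' (tm t)
tm-ren          e (ix n p) = cong var (e n p)
tm-ren          e (lam t)  = cong lam (tm-ren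
  (λ { zero (found refl) → refl ; (suc n) (found p) → cong S (e n (found p)) }) t)
tm-ren          e (t · u)  = cong₂ _·_ (tm-ren e t) (tm-ren e u)
tm-ren {r' = r} e (kon k)  = sym (ren-kon r k)
tm-ren {r' = r} e (con c)  = sym (ren-closed r c)

tm-closing : (c : Exp [] ρ) → tm (renₑ (closing {Γ = Γ}) c) ≡ closed (tm c)
tm-closing = tm-ren (λ { _ (found ()) })

tm-shift : (t : Exp Γ ρ) → tm (renₑ (shift {ρ = η}) t) ≡ wk (tm t)
tm-shift = tm-ren (λ _ _ → refl)

tm-lift : {s : SubE Γ Δ} {s' : Sub Γ Δ} → s matches s' → liftₑ {ρ = η} s matches liftS s'
tm-lift         e zero    (found refl) = refl
tm-lift {s = s} e (suc n) (found p)    = trans (tm-shift (s n (found p))) (cong wk (e n (found p)))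

tm-sub : {s : SubE Γ Δ} {s' : Sub Γ Δ} → s matches s' → (t : Exp Γ ρ) → tm (subₑ s t) ≡ sub s' (tm t)
tm-sub          e (ix n p) = e n p
tm-sub          e (lam t)  = cong lam (tm-sub (tm-lift e) t)
tm-sub          e (t · u)  = cong₂ _·_ (tm-sub e t) (tm-sub e u)
tm-sub {s' = s} e (kon k)  = sym (sub-kon s k)
tm-sub {s' = s} e (con c)  = sym (sub-closed s c)

inst-matches : (t : Exp Γ ρ) → instₑ t matches inst (tm t)
inst-matches t zero    (found refl) = refl
inst-matches t (suc n) p    = refl

data Env (Γ : Cx) : Cx → Set where
  []  : Env Γ []
  _∷_ : Exp Γ ρ → Env Γ Δ → Env Γ (ρ ∷ Δ)

at : Env Γ Δ → SubE Δ Γ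
at (t ∷ e) zero    (found refl) = t
at (t ∷ e) (suc n) (found p)    = at e n (found p)

at-tm : Env Γ Δ → Sub Δ Γ
at-tm (t ∷ e) Z     = tm t
at-tm (t ∷ e) (S x) = at-tm e x

at-matches : (e : Env Γ Δ) → at e matches at-tm e
at-matches (t ∷ e) zero    (found refl) = refl
at-matches (t ∷ e) (suc n) (found p)    = at-matches e n (found p)

subᵉ : SubE Γ Ξ → Env Γ Δ → Env Ξ Δ
subᵉ s []      = []
subᵉ s (t ∷ e) = subₑ s t ∷ subᵉ s e

at-sub : {s : SubE Γ Ξ} {s' : Sub Γ Ξ} → s matches s' → (e : Env Γ Δ) (x : Δ ∋ ρ) →
         sub s' (at-tm e x) ≡ at-tm (subᵉ s e) x
at-sub m (t ∷ e) Z     = sym (tm-sub m t)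
at-sub m (t ∷ e) (S x) = at-sub m e x

-- pred ψ e is ψ under the delayed substitution e: an atom as far as
-- substitution is concerned, so that substitution also computes on relations
-- defined by recursion on an abstract type.
data Form (Γ : Cx) : Set where
  _≐_     : Exp Γ ρ → Exp Γ ρ → Form Γ
  _∧_ _⊃_ : Form Γ → Form Γ → Form Γ
  all ex  : (ρ : Ty) → Form (ρ ∷ Γ) → Form Γ
  pred    : Form Δ → Env Γ Δ → Form Γ

fm : Form Γ → Fm Γ
fm (t ≐ u)    = tm t ≐ tm u
fm (φ ∧ ψ)    = fm φ ∧ fm ψ
fm (φ ⊃ ψ)    = fm φ ⊃ fm ψ
fm (all ρ φ)  = all ρ (fm φ)
fm (ex ρ φ)   = ex ρ (fm φ)
fm (pred ψ e) = subF (at-tm e) (fm ψ)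

subf : SubE Γ Δ → Form Γ → Form Δ
subf s (t ≐ u)    = subₑ s t ≐ subₑ s u
subf s (φ ∧ ψ)    = subf s φ ∧ subf s ψ
subf s (φ ⊃ ψ)    = subf s φ ⊃ subf s ψ
subf s (all ρ φ)  = all ρ (subf (liftₑ s) φ)
subf s (ex ρ φ)   = ex ρ (subf (liftₑ s) φ)
subf s (pred ψ e) = pred ψ (subᵉ s e)

wkf : Form Γ → Form (ρ ∷ Γ)
wkf = subf weaken

fm-sub : {s : SubE Γ Δ} {s' : Sub Γ Δ} → s matches s' → (φ : Form Γ) → fm (subf s φ) ≡ subF s' (fm φ)
fm-sub m (t ≐ u)    = cong₂ _≐_ (tm-sub m t) (tm-sub m u)
fm-sub m (φ ∧ ψ)    = cong₂ _∧_ (fm-sub m φ) (fm-sub m ψ)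
fm-sub m (φ ⊃ ψ)    = cong₂ _⊃_ (fm-sub m φ) (fm-sub m ψ)
fm-sub m (all ρ φ)  = cong (all ρ) (fm-sub (tm-lift m) φ)
fm-sub m (ex ρ φ)   = cong (ex ρ) (fm-sub (tm-lift m) φ)
fm-sub m (pred ψ d) = sym (subF-subF (at-sub m d) (fm ψ))

fm-inst : (t : Exp Γ ρ) (φ : Form (ρ ∷ Γ)) → fm (subf (instₑ t) φ) ≡ fm φ [ tm t ]
fm-inst t = fm-sub (inst-matches t)

fm-wk : (φ : Form Γ) → fm (wkf {ρ = ρ} φ) ≡ wkF (fm φ)
fm-wk = fm-sub (λ _ _ → refl)

succE : SubE (N ∷ Γ) (N ∷ Γ)
succE zero    (found refl) = kon succ · v₀
succE (suc n) (found p)    = ix (suc n) (found p)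

oldE snocE : SubE (ρ * ∷ Γ) (ρ ∷ ρ * ∷ Γ)
oldE = weaken
snocE zero    (found refl) = kon snoc · v₁ · v₀
snocE (suc n) (found p)    = ix (suc (suc n)) (found p)

-- Weakening is a constructor, so that going under a quantifier leaves the hypotheses untouched;
-- only the formula that is looked up gets weakened.
data Hyps : Cx → Set where
  []  : Hyps Γ
  _▸_ : Hyps Γ → Form Γ → Hyps Γ
  ⇑   : Hyps Γ → Hyps (ρ ∷ Γ)

fms : Hyps Γ → List (Fm Γ)
fms []      = []
fms (Θ ▸ φ) = fm φ ∷ fms Θ
fms (⇑ Θ)   = map wkF (fms Θ)

-- Out of range, the trivial equation 0 = 0.
hypothesis : Hyps Γ → ℕ → Form Γ
hypothesis []      n       = kon zero ≐ kon zero
hypothesis (Θ ▸ φ) zero    = φ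
hypothesis (Θ ▸ φ) (suc n) = hypothesis Θ n
hypothesis (⇑ Θ)   n       = wkf (hypothesis Θ n)

-- Derived rules for extended sequents

record _∣_⊩_ (Γ : Cx) (Θ : Hyps Γ) (φ : Form Γ) : Set where
  constructor ⟨_⟩
  field derivation : Γ ∣ fms Θ ⊢ fm φ
open _∣_⊩_

private variable
  Θ : Hyps Γ

module Derived where

  infix  2 _because_
  infixl 6 _$_
  infixl 7 _∙_
  infixr 5 _⨾_
  infixr 4 Λ_ ƛ_ fold_ unpack_then_ pack_▹_

  private variable
    φ ψ χ : Form Γ
    t u v : Exp Γ ρ

  private
    wk-∈ : {L : List (Fm Γ)} {α : Fm Γ} → α ∈ L → wkF {ρ = ρ} α ∈ map wkF L
    wk-∈ (here refl) = here refl
    wk-∈ (there i)   = there (wk-∈ i)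

    hypothesis-sound : (Θ : Hyps Γ) (n : ℕ) →
      (fm (hypothesis Θ n) ≡ (Zero ≐ Zero)) ⊎ (fm (hypothesis Θ n) ∈ fms Θ)
    hypothesis-sound []      n       = inj₁ refl
    hypothesis-sound (Θ ▸ φ) zero    = inj₂ (here refl)
    hypothesis-sound (Θ ▸ φ) (suc n) with hypothesis-sound Θ n
    ... | inj₁ e = inj₁ e
    ... | inj₂ i = inj₂ (there i)
    hypothesis-sound (⇑ Θ)   n with hypothesis-sound Θ n
    ... | inj₁ e = inj₁ (trans (fm-wk (hypothesis Θ n)) (cong wkF e))
    ... | inj₂ i = inj₂ (subst (λ α → α ∈ fms (⇑ Θ)) (sym (fm-wk (hypothesis Θ n))) (wk-∈ i))

  h : (n : ℕ) → Γ ∣ Θ ⊩ hypothesis Θ n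
  h {Γ} {Θ} n with hypothesis-sound Θ n
  ... | inj₁ e = ⟨ subst (λ α → Γ ∣ fms Θ ⊢ α) (sym e) ≐refl ⟩
  ... | inj₂ i = ⟨ hyp i ⟩

  h₀ : Γ ∣ Θ ⊩ hypothesis Θ 0
  h₀ = h 0

  h₁ : Γ ∣ Θ ⊩ hypothesis Θ 1
  h₁ = h 1

  ⦅_,_⦆ : Γ ∣ Θ ⊩ φ → Γ ∣ Θ ⊩ ψ → Γ ∣ Θ ⊩ φ ∧ ψ
  ⦅ ⟨ p ⟩ , ⟨ q ⟩ ⦆ = ⟨ ∧I p q ⟩

  ∧-fst : Γ ∣ Θ ⊩ φ ∧ ψ → Γ ∣ Θ ⊩ φ
  ∧-fst ⟨ p ⟩ = ⟨ ∧E₁ p ⟩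

  ∧-snd : Γ ∣ Θ ⊩ φ ∧ ψ → Γ ∣ Θ ⊩ ψ
  ∧-snd ⟨ p ⟩ = ⟨ ∧E₂ p ⟩

  ƛ_ : Γ ∣ Θ ▸ φ ⊩ ψ → Γ ∣ Θ ⊩ φ ⊃ ψ
  ƛ ⟨ p ⟩ = ⟨ ⊃I p ⟩

  _$_ : Γ ∣ Θ ⊩ φ ⊃ ψ → Γ ∣ Θ ⊩ φ → Γ ∣ Θ ⊩ ψ
  ⟨ p ⟩ $ ⟨ q ⟩ = ⟨ ⊃E p q ⟩

  cut : Γ ∣ Θ ⊩ φ → Γ ∣ Θ ▸ φ ⊩ ψ → Γ ∣ Θ ⊩ ψ
  cut p q = (ƛ q) $ p

  Λ_ : {φ : Form (ρ ∷ Γ)} → ρ ∷ Γ ∣ ⇑ Θ ⊩ φ → Γ ∣ Θ ⊩ all ρ φ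
  Λ ⟨ p ⟩ = ⟨ ∀I p ⟩

  _∙_ : {φ : Form (ρ ∷ Γ)} → Γ ∣ Θ ⊩ all ρ φ → (t : Exp Γ ρ) → Γ ∣ Θ ⊩ subf (instₑ t) φ
  _∙_ {ρ} {Γ} {Θ} {φ} ⟨ p ⟩ t = ⟨ subst (λ ψ → Γ ∣ fms Θ ⊢ ψ) (sym (fm-inst t φ)) (∀E p (tm t)) ⟩

  pack_▹_ : {φ : Form (ρ ∷ Γ)} (t : Exp Γ ρ) → Γ ∣ Θ ⊩ subf (instₑ t) φ → Γ ∣ Θ ⊩ ex ρ φ
  pack_▹_ {ρ} {Γ} {Θ} {φ} t ⟨ p ⟩ = ⟨ ∃I (tm t) (subst (λ ψ → Γ ∣ fms Θ ⊢ ψ) (fm-inst t φ) p) ⟩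

  unpack_then_ : {φ : Form (ρ ∷ Γ)} → Γ ∣ Θ ⊩ ex ρ φ → ρ ∷ Γ ∣ ⇑ Θ ▸ φ ⊩ wkf ψ → Γ ∣ Θ ⊩ ψ
  unpack_then_ {ρ} {Γ} {Θ} {ψ} {φ} ⟨ p ⟩ ⟨ q ⟩ =
    ⟨ ∃E p (subst (λ χ → ρ ∷ Γ ∣ fms (⇑ Θ ▸ φ) ⊢ χ) (fm-wk ψ) q) ⟩

  unfold : {ψ : Form Δ} {e : Env Γ Δ} → Γ ∣ Θ ⊩ pred ψ e → Γ ∣ Θ ⊩ subf (at e) ψ
  unfold {Γ = Γ} {Θ} {ψ} {e} ⟨ p ⟩ = ⟨ subst (λ χ → Γ ∣ fms Θ ⊢ χ) (sym (fm-sub (at-matches e) ψ)) p ⟩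

  fold_ : {ψ : Form Δ} {e : Env Γ Δ} → Γ ∣ Θ ⊩ subf (at e) ψ → Γ ∣ Θ ⊩ pred ψ e
  fold_ {Γ = Γ} {Θ} {ψ} {e} ⟨ p ⟩ = ⟨ subst (λ χ → Γ ∣ fms Θ ⊢ χ) (fm-sub (at-matches e) ψ) p ⟩

  rfl : Γ ∣ Θ ⊩ t ≐ t
  rfl = ⟨ ≐refl ⟩

  symm : Γ ∣ Θ ⊩ t ≐ u → Γ ∣ Θ ⊩ u ≐ t
  symm ⟨ p ⟩ = ⟨ ≐sym p ⟩

  _⨾_ : Γ ∣ Θ ⊩ t ≐ u → Γ ∣ Θ ⊩ u ≐ v → Γ ∣ Θ ⊩ t ≐ v
  ⟨ p ⟩ ⨾ ⟨ q ⟩ = ⟨ ≐trans p q ⟩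

  ap : {f g : Exp Γ (ρ ⇒ η)} → Γ ∣ Θ ⊩ f ≐ g → Γ ∣ Θ ⊩ t ≐ u → Γ ∣ Θ ⊩ f · t ≐ g · u
  ap ⟨ p ⟩ ⟨ q ⟩ = ⟨ ≐ap p q ⟩

  lam-cong : {t u : Exp (ρ ∷ Γ) η} → ρ ∷ Γ ∣ ⇑ Θ ⊩ t ≐ u → Γ ∣ Θ ⊩ lam t ≐ lam u
  lam-cong ⟨ p ⟩ = ⟨ ≐lam p ⟩

  extensionality : {f g : Exp Γ (ρ ⇒ η)} →
    ρ ∷ Γ ∣ ⇑ Θ ⊩ renₑ shift f · v₀ ≐ renₑ shift g · v₀ → Γ ∣ Θ ⊩ f ≐ g
  extensionality {Γ} {ρ} {Θ = Θ} {f} {g} ⟨ p ⟩ =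
    ⟨ ≐ext (subst₂ (λ a b → ρ ∷ Γ ∣ fms (⇑ Θ) ⊢ a · var Z ≐ b · var Z)
    (tm-shift f) (tm-shift g) p) ⟩

  replace : {t u : Exp Γ ρ} (φ : Form (ρ ∷ Γ)) → Γ ∣ Θ ⊩ t ≐ u →
            Γ ∣ Θ ⊩ subf (instₑ t) φ → Γ ∣ Θ ⊩ subf (instₑ u) φ
  replace {Γ} {Θ = Θ} {t} {u} φ ⟨ e ⟩ ⟨ p ⟩ = ⟨ subst (λ ψ → Γ ∣ fms Θ ⊢ ψ) (sym (fm-inst u φ))
    (≐repl (fm φ) e (subst (λ ψ → Γ ∣ fms Θ ⊢ ψ) (fm-inst t φ) p)) ⟩

  congr : {t u : Exp Γ η} (c : Exp (η ∷ Γ) ρ) → Γ ∣ Θ ⊩ t ≐ u →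
          Γ ∣ Θ ⊩ subₑ (instₑ t) c ≐ subₑ (instₑ u) c
  congr {Γ} {Θ = Θ} {t} {u} c ⟨ p ⟩ = ⟨ subst₂ (λ a b → Γ ∣ fms Θ ⊢ a ≐ b)
    (sym (tm-sub (inst-matches _) c))
    (sym (tm-sub (inst-matches _) c)) (≐cong (tm c) p) ⟩

  induction : (φ : Form (N ∷ Γ)) → Γ ∣ Θ ⊩ subf (instₑ (kon zero)) φ →
              Γ ∣ Θ ⊩ all N (φ ⊃ subf succE φ) → Γ ∣ Θ ⊩ all N φ
  induction {Γ} {Θ} φ ⟨ p ⟩ ⟨ q ⟩ = ⟨ ind (fm φ)
    (subst (λ ψ → Γ ∣ fms Θ ⊢ ψ) (fm-inst (kon zero) φ) p)
    (subst (λ ψ → Γ ∣ fms Θ ⊢ all N (fm φ ⊃ ψ))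
      (fm-sub (λ { zero (found refl) → refl ; (suc n) p → refl }) φ) q) ⟩

  list-induction : (φ : Form (ρ * ∷ Γ)) → Γ ∣ Θ ⊩ subf (instₑ (kon nil)) φ →
                   Γ ∣ Θ ⊩ all (ρ *) (all ρ (subf oldE φ ⊃ subf snocE φ)) → Γ ∣ Θ ⊩ all (ρ *) φ
  list-induction {ρ} {Γ} {Θ} φ ⟨ p ⟩ ⟨ q ⟩ = ⟨ sind (fm φ)
    (subst (λ ψ → Γ ∣ fms Θ ⊢ ψ) (fm-inst (kon nil) φ) p)
    (subst₂ (λ ψ χ → Γ ∣ fms Θ ⊢ all (ρ *) (all ρ (ψ ⊃ χ)))
      (fm-sub (λ _ _ → refl) φ) (fm-sub (λ { zero (found refl) → refl ; (suc n) p → refl }) φ) q) ⟩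

  absurd : (t : Exp Γ N) {φ : Form Γ} → Γ ∣ Θ ⊩ kon succ · t ≐ kon zero → Γ ∣ Θ ⊩ φ
  absurd t ⟨ p ⟩ = ⟨ ⊥E (⊃E (succ≠0 _) p) ⟩

  unfold-con : (c : Exp [] ρ) → Γ ∣ Θ ⊩ con (tm c) ≐ renₑ closing c
  unfold-con {Γ = Γ} {Θ} c = ⟨ subst (λ w → Γ ∣ fms Θ ⊢ closed (tm c) ≐ w) (sym (tm-closing c)) ≐refl ⟩

  -- A sound βη-normaliser, which also computes the recursors on constructors.
  -- The number bounds the nesting of contractions.

  record Reduct (t : Exp Γ ρ) : Set where
    constructor _because_
    field
      result : Exp Γ ρ
      proof  : ∀ {Θ} → Γ ∣ Θ ⊩ t ≐ result
  open Reduct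

  contract : (f : Exp Γ (ρ ⇒ η)) (u : Exp Γ ρ) → Maybe (Reduct (f · u))
  contract {Γ} (lam t) u = just (subₑ (instₑ u) t because λ {Θ} →
    ⟨ subst (λ w → Γ ∣ fms Θ ⊢ lam (tm t) · tm u ≐ w)
        (sym (tm-sub (inst-matches u) t)) (β (tm t) (tm u)) ⟩)
  contract (kon rec · a · f) (kon zero) = just (a because ⟨ rec0 _ _ ⟩)
  contract (kon rec · a · f) (kon succ · m) =
    just (f · m · (kon rec · a · f · m) because ⟨ recS _ _ _ ⟩)
  contract (kon srec · a · f) (kon nil) = just (a because ⟨ srec0 _ _ ⟩)
  contract (kon srec · a · f) (kon snoc · s · x) =
    just (f · s · x · (kon srec · a · f · s) because ⟨ srecS _ _ _ _ ⟩)
  contract (kon fst) (kon pair · a · b) = just (a because ⟨ fst _ _ ⟩)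
  contract (kon snd) (kon pair · a · b) = just (b because ⟨ snd _ _ ⟩)
  contract _ _ = nothing

  -- An η-redex is recognised by undoing the shift on its function part. Under binders the renaming
  -- to be undone is a lifted shift, so preimages are sought for an arbitrary renaming.
  PreImage : RenE Γ Δ → (n : ℕ) → At Δ n ρ → Set
  PreImage {Γ} {ρ = ρ} r n p = Σ ℕ λ m → Σ (At Γ m ρ) λ q → r m q ≡ (n , p)

  lift-preimage : {r : RenE Γ Δ} → (∀ {ρ} n (p : At Δ n ρ) → Maybe (PreImage r n p)) →
                  ∀ {ρ} n (p : At (η ∷ Δ) n ρ) → Maybe (PreImage (liftʳ {ρ = η} r) n p)
  lift-preimage f zero    (found p) = just (zero , found p , refl)
  lift-preimage f (suc n) (found p) with f n (found p)
  ... | just (m , found q , refl) = just (suc m , found q , refl)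
  ... | nothing             = nothing

  strengthen : {r : RenE Γ Δ} → (∀ {ρ} n (p : At Δ n ρ) → Maybe (PreImage r n p)) →
               (t : Exp Δ ρ) → Maybe (Σ (Exp Γ ρ) λ u → renₑ r u ≡ t)
  strengthen f (ix n p) with f n p
  ... | just (m , q , refl) = just (ix m q , refl)
  ... | nothing             = nothing
  strengthen f (lam t) with strengthen (lift-preimage f) t
  ... | just (u , e) = just (lam u , cong lam e)
  ... | nothing      = nothing
  strengthen f (t · u) with strengthen f t
  ... | nothing = nothing
  ... | just (t' , e) with strengthen f u
  ...   | just (u' , e') = just (t' · u' , cong₂ _·_ e e')
  ...   | nothing        = nothing
  strengthen f (kon k) = just (kon k , refl)
  strengthen f (con c) = just (con c , refl)

  unshift : ∀ n (p : At (η ∷ Γ) n ρ) → Maybe (PreImage {Γ} shift n p)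
  unshift zero    _         = nothing
  unshift (suc n) (found p) = just (n , found p , refl)

  unweaken : (t : Exp (ρ ∷ Γ) η) → Maybe (Σ (Exp Γ η) λ u → renₑ (shift {ρ = ρ}) u ≡ t)
  unweaken {ρ} {Γ} = strengthen {r = shift {ρ = ρ}} (unshift {ρ} {Γ})

  contract-η : (t : Exp (ρ ∷ Γ) η) → Maybe (Reduct (lam t))
  contract-η (f · v₀) with unweaken f
  ... | just (g , refl) = just (g because λ {Θ} →
          ⟨ subst (λ w → _ ∣ fms Θ ⊢ lam (w · var Z) ≐ tm g) (sym (tm-shift g)) (≐η (tm g)) ⟩)
  ... | nothing = nothing
  contract-η _ = nothing

  nf : ℕ → Exp Γ ρ → Exp Γ ρ
  nf-app : ℕ → Exp Γ (ρ ⇒ η) → Exp Γ ρ → Exp Γ η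
  nf-lam : Exp (ρ ∷ Γ) η → Exp Γ (ρ ⇒ η)

  nf n (ix m p) = ix m p
  nf n (lam t) = nf-lam (nf n t)
  nf n (t · u) = nf-app n (nf n t) (nf n u)
  nf n (kon k) = kon k
  nf n (con c) = con c

  nf-app zero t u = t · u
  nf-app (suc n) t u with contract t u
  ... | just r  = nf n (result r)
  ... | nothing = t · u

  nf-lam t with contract-η t
  ... | just r  = result r
  ... | nothing = lam t

  nf-sound : (n : ℕ) (t : Exp Γ ρ) → Γ ∣ Θ ⊩ t ≐ nf n t
  nf-app-sound : (n : ℕ) (t : Exp Γ (ρ ⇒ η)) (u : Exp Γ ρ) → Γ ∣ Θ ⊩ t · u ≐ nf-app n t u
  nf-lam-sound : (t : Exp (ρ ∷ Γ) η) → Γ ∣ Θ ⊩ lam t ≐ nf-lam t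

  nf-sound n (ix m p) = rfl
  nf-sound n (lam t) = lam-cong (nf-sound n t) ⨾ nf-lam-sound (nf n t)
  nf-sound n (t · u) = ap (nf-sound n t) (nf-sound n u) ⨾ nf-app-sound n (nf n t) (nf n u)
  nf-sound n (kon k) = rfl
  nf-sound n (con c) = rfl

  nf-app-sound zero t u = rfl
  nf-app-sound (suc n) t u with contract t u
  ... | just r  = proof r ⨾ nf-sound n (result r)
  ... | nothing = rfl

  nf-lam-sound t with contract-η t
  ... | just r  = proof r
  ... | nothing = rfl

  nfᵉ : ℕ → Env Γ Δ → Env Γ Δ
  nfᵉ n []      = []
  nfᵉ n (t ∷ e) = nf n t ∷ nfᵉ n e

  nff : ℕ → Form Γ → Form Γ
  nff n (t ≐ u)    = nf n t ≐ nf n u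
  nff n (φ ∧ ψ)    = nff n φ ∧ nff n ψ
  nff n (φ ⊃ ψ)    = nff n φ ⊃ nff n ψ
  nff n (all ρ φ)  = all ρ (nff n φ)
  nff n (ex ρ φ)   = ex ρ (nff n φ)
  nff n (pred ψ e) = pred ψ (nfᵉ n e)

  -- Replacement of provably equal terms in delayed substitutions

  data Equal (Θ : Hyps Γ) : Env Γ Δ → Env Γ Δ → Set where
    []  : Equal Θ [] []
    _∷_ : {t u : Exp Γ ρ} {d e : Env Γ Δ} →
          Γ ∣ Θ ⊩ t ≐ u → Equal Θ d e → Equal Θ (t ∷ d) (u ∷ e)

  extend : Env Γ Δ → Sub (Δ ++ Γ) Γ
  extend []      x     = var x
  extend (t ∷ e) Z     = tm t
  extend (t ∷ e) (S x) = extend e x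

  inl : Ren Δ (Δ ++ Γ)
  inl Z     = Z
  inl (S x) = S (inl x)

  inr : (Δ : Cx) → Ren Γ (Δ ++ Γ)
  inr []      x = x
  inr (_ ∷ Δ) x = S (inr Δ x)

  extend-inl : (e : Env Γ Δ) (x : Δ ∋ ρ) → extend e (inl x) ≡ at-tm e x
  extend-inl (t ∷ e) Z     = refl
  extend-inl (t ∷ e) (S x) = extend-inl e x

  extend-inr : (e : Env Γ Δ) (x : Γ ∋ ρ) → extend e (inr Δ x) ≡ var x
  extend-inr []      x = refl
  extend-inr (t ∷ e) x = extend-inr e x

  -- The terms are exchanged one at a time: the old head is first substituted into `χ`, the tail is
  -- replaced by recursion, and Leibniz's rule then exchanges the head. Since the head lives in `Γ`,
  -- `χ` has to range over `Δ ++ Γ`.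
  replace-extend : {d e : Env Γ Δ} → Equal Θ d e → (χ : Fm (Δ ++ Γ)) →
    Γ ∣ fms Θ ⊢ subF (extend d) χ → Γ ∣ fms Θ ⊢ subF (extend e) χ
  replace-extend [] χ p = p
  replace-extend {Γ} {Δ = ρ ∷ Δ} {Θ = Θ} {d = t ∷ d} {u ∷ e} (⟨ q ⟩ ∷ qs) χ p =
    subst (λ ψ → Γ ∣ fms Θ ⊢ ψ) (instantiate u)
      (≐repl (subF (liftS (extend e)) χ) q
        (subst (λ ψ → Γ ∣ fms Θ ⊢ ψ) (trans (reassemble e) (sym (instantiate t)))
          (replace-extend qs (χ [ ren (inr Δ) (tm t) ])
            (subst (λ ψ → Γ ∣ fms Θ ⊢ ψ) (sym (reassemble d)) p))))
    where
    instantiate : (v : Exp Γ ρ) → subF (liftS (extend e)) χ [ tm v ] ≡ subF (extend (v ∷ e)) χ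
    instantiate v = subF-subF (λ { Z → refl ; (S x) → inst-wk (tm v) (extend e x) }) χ
    reassemble : (c : Env Γ Δ) → subF (extend c) (χ [ ren (inr Δ) (tm t) ]) ≡ subF (extend (t ∷ c)) χ
    reassemble c = subF-subF (λ { Z → trans (sub-ren (extend-inr c) (tm t)) (sub-id (λ _ → refl) (tm t))
                            ; (S x) → refl }) χ

  replaceᵉ : {ψ : Form Δ} {d e : Env Γ Δ} → Equal Θ d e → Γ ∣ Θ ⊩ pred ψ d → Γ ∣ Θ ⊩ pred ψ e
  replaceᵉ {Δ} {Γ} {Θ} {ψ} {d} {e} q ⟨ p ⟩ =
    ⟨ subst (λ φ → Γ ∣ fms Θ ⊢ φ) (split e)
        (replace-extend q (subF (λ x → var (inl x)) (fm ψ))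
          (subst (λ φ → Γ ∣ fms Θ ⊢ φ) (sym (split d)) p)) ⟩
    where
    split : (c : Env Γ Δ) →
            subF (extend c) (subF (λ x → var (inl x)) (fm ψ)) ≡ subF (at-tm c) (fm ψ)
    split c = subF-subF (extend-inl c) (fm ψ)

  nfᵉ-sound : (n : ℕ) (e : Env Γ Δ) → Equal Θ e (nfᵉ n e)
  nfᵉ-sound n []      = []
  nfᵉ-sound n (t ∷ e) = nf-sound n t ∷ nfᵉ-sound n e

  nfᵉ-sound⁻ : (n : ℕ) (e : Env Γ Δ) → Equal Θ (nfᵉ n e) e
  nfᵉ-sound⁻ n []      = []
  nfᵉ-sound⁻ n (t ∷ e) = symm (nf-sound n t) ∷ nfᵉ-sound⁻ n e

  -- A quantified hypothesis used under its own quantifier is weakened and then instantiated at the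
  -- fresh variable; `map-all` and `map-ex` need to get the original body back.
  fm-generic : (φ : Form (ρ ∷ Γ)) →
               fm (subf (instₑ v₀) (subf (liftₑ weaken) φ)) ≡ fm φ
  fm-generic φ =
    trans (fm-inst v₀ (subf (liftₑ weaken) φ))
      (trans (cong (subF (inst (var Z)))
        (fm-sub {s' = liftS (λ x → var (S x))} (tm-lift (λ _ _ → refl)) φ))
        (trans (subF-subF (λ _ → refl) (fm φ)) (subF-id (λ { Z → refl ; (S x) → refl }) (fm φ))))

  cast : fm φ ≡ fm ψ → Γ ∣ Θ ⊩ φ → Γ ∣ Θ ⊩ ψ
  cast {Γ} {Θ = Θ} e ⟨ p ⟩ = ⟨ subst (λ χ → Γ ∣ fms Θ ⊢ χ) e p ⟩

  map-all : {φ ψ : Form (ρ ∷ Γ)} → (∀ {Θ} → ρ ∷ Γ ∣ Θ ⊩ φ ⊃ ψ) → Γ ∣ Θ ⊩ all ρ φ ⊃ all ρ ψ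
  map-all {φ = φ} p = ƛ (Λ (p $ cast (fm-generic φ) (h₀ ∙ v₀)))

  map-ex : {φ ψ : Form (ρ ∷ Γ)} → (∀ {Θ} → ρ ∷ Γ ∣ Θ ⊩ φ ⊃ ψ) → Γ ∣ Θ ⊩ ex ρ φ ⊃ ex ρ ψ
  map-ex {ψ = ψ} p = ƛ unpack h₀ then pack v₀ ▹ cast (sym (fm-generic ψ)) (p $ h₀)

  -- The two directions go together because the premise of an implication is converted the opposite
  -- way.
  nff-sound  : (n : ℕ) (φ : Form Γ) → Γ ∣ Θ ⊩ φ ⊃ nff n φ
  nff-sound⁻ : (n : ℕ) (φ : Form Γ) → Γ ∣ Θ ⊩ nff n φ ⊃ φ
  nff-sound n (t ≐ u)    = ƛ (symm (nf-sound n t) ⨾ h₀ ⨾ nf-sound n u)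
  nff-sound n (φ ∧ ψ)    = ƛ (⦅ nff-sound n φ $ ∧-fst h₀ , nff-sound n ψ $ ∧-snd h₀ ⦆)
  nff-sound n (φ ⊃ ψ)    = ƛ (ƛ (nff-sound n ψ $ (h₁ $ (nff-sound⁻ n φ $ h₀))))
  nff-sound n (all ρ φ)  = map-all (nff-sound n φ)
  nff-sound n (ex ρ φ)   = map-ex (nff-sound n φ)
  nff-sound n (pred ψ e) = ƛ (replaceᵉ (nfᵉ-sound n e) h₀)
  nff-sound⁻ n (t ≐ u)    = ƛ (nf-sound n t ⨾ h₀ ⨾ symm (nf-sound n u))
  nff-sound⁻ n (φ ∧ ψ)    = ƛ (⦅ nff-sound⁻ n φ $ ∧-fst h₀ , nff-sound⁻ n ψ $ ∧-snd h₀ ⦆)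
  nff-sound⁻ n (φ ⊃ ψ)    = ƛ (ƛ (nff-sound⁻ n ψ $ (h₁ $ (nff-sound n φ $ h₀))))
  nff-sound⁻ n (all ρ φ)  = map-all (nff-sound⁻ n φ)
  nff-sound⁻ n (ex ρ φ)   = map-ex (nff-sound⁻ n φ)
  nff-sound⁻ n (pred ψ e) = ƛ (replaceᵉ (nfᵉ-sound⁻ n e) h₀)

  -- Soundness holds for every bound; this one is large enough for all conversions below.
  depth : ℕ
  depth = 40

  compute : {t u : Exp Γ ρ} → nf depth t ≡ nf depth u → Γ ∣ Θ ⊩ t ≐ u
  compute {Γ} {Θ = Θ} {t} {u} e =
    nf-sound depth t ⨾ subst (λ w → Γ ∣ Θ ⊩ w ≐ u) (sym e) (symm (nf-sound depth u))

  conv : nff depth φ ≡ nff depth ψ → Γ ∣ Θ ⊩ φ → Γ ∣ Θ ⊩ ψ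
  conv {Γ} {φ} {ψ} {Θ} e p =
    nff-sound⁻ depth ψ $ subst (λ χ → Γ ∣ Θ ⊩ χ) e (nff-sound depth φ $ p)

-- Proof terms

open Derived using (nf; nff; depth)

infixl 6 _$_
infixl 7 _∙_
infixr 5 _⨾_
infixr 4 Λ_ ƛ_ fold_ unpack_then_ pack_▹_

-- The sequent is a parameter, so that proof terms carry no copies of it.
data _∣_⊨_ (Γ : Cx) (Θ : Hyps Γ) (φ : Form Γ) : Set where
  hyp        : (n : ℕ) → hypothesis Θ n ≡ φ → Γ ∣ Θ ⊨ φ
  by         : {ψ : (Δ : Cx) → Form Δ} → (∀ {Δ} {Ξ : Hyps Δ} → Δ ∣ Ξ ⊨ ψ Δ) → ψ Γ ≡ φ → Γ ∣ Θ ⊨ φ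
  both       : {ψ χ : Form Γ} → (ψ ∧ χ) ≡ φ → Γ ∣ Θ ⊨ ψ → Γ ∣ Θ ⊨ χ → Γ ∣ Θ ⊨ φ
  ∧-fst      : {ψ : Form Γ} → Γ ∣ Θ ⊨ φ ∧ ψ → Γ ∣ Θ ⊨ φ
  ∧-snd      : {ψ : Form Γ} → Γ ∣ Θ ⊨ ψ ∧ φ → Γ ∣ Θ ⊨ φ
  assume     : {ψ χ : Form Γ} → (ψ ⊃ χ) ≡ φ → Γ ∣ Θ ▸ ψ ⊨ χ → Γ ∣ Θ ⊨ φ
  _$_        : {ψ : Form Γ} → Γ ∣ Θ ⊨ ψ ⊃ φ → Γ ∣ Θ ⊨ ψ → Γ ∣ Θ ⊨ φ
  cut        : {ψ : Form Γ} → Γ ∣ Θ ⊨ ψ → Γ ∣ Θ ▸ ψ ⊨ φ → Γ ∣ Θ ⊨ φ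
  generalise : {ψ : Form (ρ ∷ Γ)} → all ρ ψ ≡ φ → ρ ∷ Γ ∣ ⇑ Θ ⊨ ψ → Γ ∣ Θ ⊨ φ
  specialise : {ψ : Form (ρ ∷ Γ)} → Γ ∣ Θ ⊨ all ρ ψ → (t : Exp Γ ρ) → subf (instₑ t) ψ ≡ φ → Γ ∣ Θ ⊨ φ
  witness    : {ψ : Form (ρ ∷ Γ)} → ex ρ ψ ≡ φ → (t : Exp Γ ρ) → Γ ∣ Θ ⊨ subf (instₑ t) ψ → Γ ∣ Θ ⊨ φ
  unpack_then_ : {ψ : Form (ρ ∷ Γ)} → Γ ∣ Θ ⊨ ex ρ ψ → ρ ∷ Γ ∣ ⇑ Θ ▸ ψ ⊨ wkf φ → Γ ∣ Θ ⊨ φ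
  unfolded   : {ψ : Form Δ} {e : Env Γ Δ} → Γ ∣ Θ ⊨ pred ψ e → subf (at e) ψ ≡ φ → Γ ∣ Θ ⊨ φ
  folded     : {ψ : Form Δ} {e : Env Γ Δ} → pred ψ e ≡ φ → Γ ∣ Θ ⊨ subf (at e) ψ → Γ ∣ Θ ⊨ φ
  reflexive  : {t : Exp Γ ρ} → (t ≐ t) ≡ φ → Γ ∣ Θ ⊨ φ
  symmetric  : {t u : Exp Γ ρ} → Γ ∣ Θ ⊨ t ≐ u → (u ≐ t) ≡ φ → Γ ∣ Θ ⊨ φ
  transitive : {t u v : Exp Γ ρ} → Γ ∣ Θ ⊨ t ≐ u → Γ ∣ Θ ⊨ u ≐ v → (t ≐ v) ≡ φ → Γ ∣ Θ ⊨ φ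
  congruent  : {t u : Exp Γ η} (c : Exp (η ∷ Γ) ρ) → Γ ∣ Θ ⊨ t ≐ u →
               (subₑ (instₑ t) c ≐ subₑ (instₑ u) c) ≡ φ → Γ ∣ Θ ⊨ φ
  replaced   : {t u : Exp Γ ρ} (ψ : Form (ρ ∷ Γ)) → Γ ∣ Θ ⊨ t ≐ u → Γ ∣ Θ ⊨ subf (instₑ t) ψ →
               subf (instₑ u) ψ ≡ φ → Γ ∣ Θ ⊨ φ
  extensional : {f g : Exp Γ (ρ ⇒ η)} →
               ρ ∷ Γ ∣ ⇑ Θ ⊨ renₑ shift f · v₀ ≐ renₑ shift g · v₀ → (f ≐ g) ≡ φ → Γ ∣ Θ ⊨ φ
  recast     : {ψ : Form Γ} → fm ψ ≡ fm φ → Γ ∣ Θ ⊨ ψ → Γ ∣ Θ ⊨ φ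
  surjective : (p : Exp Γ (ρ ⊗ η)) → (kon pair · (kon fst · p) · (kon snd · p) ≐ p) ≡ φ → Γ ∣ Θ ⊨ φ
  constant   : (c : Exp [] ρ) → (con (tm c) ≐ renₑ closing c) ≡ φ → Γ ∣ Θ ⊨ φ
  by-induction  : (ψ : Form (N ∷ Γ)) → Γ ∣ Θ ⊨ subf (instₑ (kon zero)) ψ →
               Γ ∣ Θ ⊨ all N (ψ ⊃ subf succE ψ) → all N ψ ≡ φ → Γ ∣ Θ ⊨ φ
  by-list-induction : (ψ : Form (ρ * ∷ Γ)) → Γ ∣ Θ ⊨ subf (instₑ (kon nil)) ψ →
               Γ ∣ Θ ⊨ all (ρ *) (all ρ (subf oldE ψ ⊃ subf snocE ψ)) → all (ρ *) ψ ≡ φ → Γ ∣ Θ ⊨ φ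
  absurd     : (t : Exp Γ N) → Γ ∣ Θ ⊨ kon succ · t ≐ kon zero → Γ ∣ Θ ⊨ φ
  computed   : {t u : Exp Γ ρ} → nf depth t ≡ nf depth u → (t ≐ u) ≡ φ → Γ ∣ Θ ⊨ φ
  conv       : {ψ : Form Γ} → nff depth ψ ≡ nff depth φ → Γ ∣ Θ ⊨ ψ → Γ ∣ Θ ⊨ φ

pattern ƛ_ p        = assume refl p
pattern Λ_ p        = generalise refl p
pattern _∙_ p t     = specialise p t refl
pattern pack_▹_ t p = witness refl t p
pattern ⦅_,_⦆ p q   = both refl p q
pattern unfold p    = unfolded p refl
pattern fold_ p     = folded refl p
pattern rfl         = reflexive refl
pattern symm p      = symmetric p refl
pattern _⨾_ p q     = transitive p q refl
pattern congr c p   = congruent c p refl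
pattern replace ψ e p = replaced ψ e p refl
pattern extensionality p = extensional p refl
pattern unfold-con c = constant c refl
pattern induction ψ p q = by-induction ψ p q refl
pattern list-induction ψ p q = by-list-induction ψ p q refl
pattern surj p      = surjective p refl
pattern compute     = computed refl refl
pattern use l       = by l refl
pattern cases ψ p q = by-induction ψ p (generalise refl (assume refl q)) refl
pattern list-cases ψ p q = by-list-induction ψ p
  (generalise refl (generalise refl (assume refl q))) refl
pattern h₀ = hyp 0 refl
pattern h₁ = hyp 1 refl
pattern h₂ = hyp 2 refl
pattern h₃ = hyp 3 refl
pattern h₄ = hyp 4 refl
pattern h₅ = hyp 5 refl

soundness : {φ : Form Γ} → Γ ∣ Θ ⊨ φ → Γ ∣ Θ ⊩ φ
soundness (hyp n refl) = Derived.h n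
soundness (by l refl) = soundness l
soundness (both refl p q) = Derived.⦅ soundness p , soundness q ⦆
soundness (∧-fst p) = Derived.∧-fst (soundness p)
soundness (∧-snd p) = Derived.∧-snd (soundness p)
soundness (assume refl p) = Derived.ƛ soundness p
soundness (p $ q) = soundness p Derived.$ soundness q
soundness (cut p q) = Derived.cut (soundness p) (soundness q)
soundness (generalise refl p) = Derived.Λ soundness p
soundness (specialise p t refl) = soundness p Derived.∙ t
soundness (witness refl t p) = Derived.pack t ▹ soundness p
soundness (unpack p then q) = Derived.unpack soundness p then soundness q
soundness (unfolded p refl) = Derived.unfold (soundness p)
soundness (folded refl p) = Derived.fold soundness p
soundness (reflexive refl) = Derived.rfl
soundness (symmetric p refl) = Derived.symm (soundness p)
soundness (transitive p q refl) = soundness p Derived.⨾ soundness q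
soundness (congruent c p refl) = Derived.congr c (soundness p)
soundness (replaced ψ e p refl) = Derived.replace ψ (soundness e) (soundness p)
soundness (extensional p refl) = Derived.extensionality (soundness p)
soundness (recast e p) = Derived.cast e (soundness p)
soundness (surjective p refl) = ⟨ pair (tm p) ⟩
soundness (constant c refl) = Derived.unfold-con c
soundness (by-induction ψ p q refl) = Derived.induction ψ (soundness p) (soundness q)
soundness (by-list-induction ψ p q refl) = Derived.list-induction ψ (soundness p) (soundness q)
soundness (absurd t p) = Derived.absurd t (soundness p)
soundness (computed e refl) = Derived.compute e
soundness (conv e p) = Derived.conv e (soundness p)

-- Quotation of terms of system T

index : Γ ∋ ρ → ℕ
index Z     = zero
index (S x) = suc (index x)

index-correct : (x : Γ ∋ ρ) → Γ ‼ index x ≡ just ρ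
index-correct Z     = refl
index-correct (S x) = index-correct x

⌜_⌝ : Tm Γ ρ → Exp Γ ρ
⌜ var x ⌝ = ix (index x) (found (index-correct x))
⌜ lam t ⌝ = lam ⌜ t ⌝
⌜ t · u ⌝ = ⌜ t ⌝ · ⌜ u ⌝
⌜ Zero ⌝  = kon zero
⌜ Succ ⌝  = kon succ
⌜ Rec ⌝   = kon rec
⌜ Pair ⌝  = kon pair
⌜ Fst ⌝   = kon fst
⌜ Snd ⌝   = kon snd
⌜ Nil ⌝   = kon nil
⌜ Snoc ⌝  = kon snoc
⌜ SRec ⌝  = kon srec

O : Exp Γ N
O = kon zero

s⁺ : Exp Γ N → Exp Γ N
s⁺ m = kon succ · m

infixl 18 _∷ʳ_
_∷ʳ_ : Exp Γ (ρ *) → Exp Γ ρ → Exp Γ (ρ *)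
s ∷ʳ x = kon snoc · s · x

⟪_,_⟫ : Exp Γ ρ → Exp Γ η → Exp Γ (ρ ⊗ η)
⟪ a , b ⟫ = kon pair · a · b

π₁ : Exp Γ (ρ ⊗ η) → Exp Γ ρ
π₁ p = kon fst · p

π₂ : Exp Γ (ρ ⊗ η) → Exp Γ η
π₂ p = kon snd · p

-- Arithmetic

predᵉ : Exp Γ (N ⇒ N)
predᵉ = kon rec · O · lam (lam v₁)

monus : Exp Γ N → Exp Γ N → Exp Γ N
monus a b = kon rec · a · lam predᵉ · b

-- `monus` recurs on its second argument, which is therefore quantified first; each induction step
-- applies `predᵉ` to both sides.
monus-suc : Γ ∣ Θ ⊨ all N (all N (monus (s⁺ v₀) (s⁺ v₁) ≐ monus v₀ v₁))
monus-suc = induction _ (Λ compute) (Λ ƛ Λ conv refl (congr (predᵉ · v₀) (h₀ ∙ v₀)))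

-- `cond` computes to its second branch only on a visible successor, so i < n is turned into one for
-- the distance of i and n.
apart : Γ ∣ Θ ⊨ all N (all N (monus (s⁺ v₁) v₀ ≐ O ⊃ ex N (⌜ dist ⌝ · v₂ · v₁ ≐ s⁺ v₀)))
apart = induction _
  (cases _ (ƛ absurd O (conv refl h₀)) (ƛ pack v₀ ▹ compute))
  (Λ ƛ cases _ (ƛ absurd (s⁺ v₀) (conv refl h₀))
    (ƛ unpack h₂ ∙ v₀ $ (symm (use monus-suc ∙ v₀ ∙ s⁺ v₁) ⨾ h₀) then pack v₀ ▹ conv refl h₀))

plus-suc : Γ ∣ Θ ⊨ all N (all N (⌜ plus ⌝ · s⁺ v₁ · v₀ ≐ s⁺ (⌜ plus ⌝ · v₁ · v₀)))
plus-suc = Λ induction _ (compute) (Λ ƛ conv refl (congr (s⁺ v₀) h₀))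

monus-self : Γ ∣ Θ ⊨ all N (monus v₀ v₀ ≐ O)
monus-self = induction _ (compute) (Λ ƛ use monus-suc ∙ v₀ ∙ v₀ ⨾ h₀)

-- This and `suc-plus-monus` decide the test in `step`: the difference is zero if t(ŝ) < |s|, and a
-- successor if t(ŝ) ≥ |s|.
monus-plus : Γ ∣ Θ ⊨ all N (all N (monus v₁ (⌜ plus ⌝ · v₁ · v₀) ≐ O))
monus-plus = Λ induction _ (conv refl (use monus-self ∙ v₀)) (Λ ƛ conv refl (congr (predᵉ · v₀) h₀))

suc-plus-monus : Γ ∣ Θ ⊨ all N (all N (monus (s⁺ (⌜ plus ⌝ · v₁ · v₀)) v₁ ≐ s⁺ v₀))
suc-plus-monus = induction _
  (induction _ (compute) (Λ ƛ conv refl (congr (s⁺ v₀) h₀)))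
  (Λ ƛ Λ (congr (monus (s⁺ v₀) (s⁺ v₂)) (use plus-suc ∙ v₁ ∙ v₀)
    ⨾ use monus-suc ∙ v₁ ∙ s⁺ (⌜ plus ⌝ · v₁ · v₀) ⨾ h₀ ∙ v₀))

-- Finite sequences

append : Exp Γ (ρ *) → Exp Γ (ρ *) → Exp Γ (ρ *)
append s r = kon srec · s · lam (lam (lam (v₀ ∷ʳ v₁))) · r

-- Every entry u of p satisfies Q(u,z), where p and z are the free variables;
-- an entry is given by a decomposition p = (q * u) * r.
Every : Form (ρ ∷ η ∷ []) → Form (ρ * ∷ η ∷ [])
Every {ρ} Q = all (ρ *) (all ρ (all (ρ *)
  (append (v₂ ∷ʳ v₁) v₀ ≐ v₃ ⊃ pred Q (v₁ ∷ v₄ ∷ []))))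

-- The calculus has no injectivity rules for sequences. Equations between sequences are instead
-- passed through `nonempty`, `init` and `lastOr`.
nonempty : Exp Γ (ρ *) → Exp Γ N
nonempty s = kon srec · O · lam (lam (lam (s⁺ O))) · s

init : Exp Γ (ρ * ⇒ ρ *)
init = kon srec · kon nil · lam (lam (lam v₂))

lastOr : Exp Γ (ρ ⇒ ρ * ⇒ ρ)
lastOr = lam (kon srec · v₀ · lam (lam (lam v₁)))

every-nil : (Q : Form (ρ ∷ η ∷ [])) → Γ ∣ Θ ⊨ all η (pred (Every Q) (kon nil ∷ v₀ ∷ []))
every-nil Q = Λ fold Λ Λ list-cases _
  (ƛ absurd O (conv refl (congr (nonempty v₀) h₀)))
  (ƛ absurd O (conv refl (congr (nonempty v₀) h₀)))

every-snoc : (Q : Form (ρ ∷ η ∷ [])) → Γ ∣ Θ ⊨ all η (all (ρ *) (all ρ (pred (Every Q) (v₁ ∷ v₂ ∷ []) ⊃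
  pred Q (v₀ ∷ v₂ ∷ []) ⊃ pred (Every Q) (v₁ ∷ʳ v₀ ∷ v₂ ∷ []))))
every-snoc Q = Λ Λ Λ ƛ ƛ fold Λ Λ list-cases _
  -- With an empty remainder the chosen entry is the appended one. Both sequences are nonempty, so
  -- the default given to `lastOr` does not matter.
  (ƛ conv refl (replace (pred Q (lastOr · v₃ · v₀ ∷ v₅ ∷ [])) (symm h₀) (conv refl h₁)))
  (ƛ unfold h₃ ∙ v₃ ∙ v₂ ∙ v₁ $ conv refl (congr (init · v₀) h₀))

every-init : (Q : Form (ρ ∷ η ∷ [])) → Γ ∣ Θ ⊨ all η (all (ρ *) (all ρ
  (pred (Every Q) (v₁ ∷ʳ v₀ ∷ v₂ ∷ []) ⊃ pred (Every Q) (v₁ ∷ v₂ ∷ []))))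
every-init Q = Λ Λ Λ ƛ fold Λ Λ Λ ƛ unfold h₁ ∙ v₂ ∙ v₁ ∙ (v₀ ∷ʳ v₃) $ conv refl (congr (v₀ ∷ʳ v₄) h₀)

every-last : (Q : Form (ρ ∷ η ∷ [])) → Γ ∣ Θ ⊨ all η (all (ρ *) (all ρ
  (pred (Every Q) (v₁ ∷ʳ v₀ ∷ v₂ ∷ []) ⊃ pred Q (v₀ ∷ v₂ ∷ []))))
every-last Q = Λ Λ Λ ƛ unfold h₀ ∙ v₁ ∙ v₀ ∙ kon nil $ compute

-- Combinatory terms

data Comb (Γ : Cx) : Ty → Set where
  var : Γ ∋ ρ → Comb Γ ρ
  _·_ : Comb Γ (ρ ⇒ η) → Comb Γ ρ → Comb Γ η
  kon : Const ρ → Comb Γ ρ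
  I′  : Comb Γ (ρ ⇒ ρ)
  K′  : Comb Γ (ρ ⇒ η ⇒ ρ)
  S′  : Comb Γ ((ρ ⇒ η ⇒ θ) ⇒ (ρ ⇒ η) ⇒ ρ ⇒ θ)

source : Comb Γ ρ → Tm Γ ρ
source (var x) = var x
source (c · d) = source c · source d
source (kon k) = kon-tm k
source I′      = lam (var Z)
source K′      = lam (lam (var (S Z)))
source S′      = lam (lam (lam (var (S (S Z)) · var Z · (var (S Z) · var Z))))

abstraction : Comb (ρ ∷ Γ) η → Comb Γ (ρ ⇒ η)
abstraction (var Z)     = I′
abstraction (var (S x)) = K′ · var x
abstraction (c · d)     = S′ · abstraction c · abstraction d
abstraction (kon k)     = K′ · kon k
abstraction I′          = K′ · I′
abstraction K′          = K′ · K′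
abstraction S′          = K′ · S′

compile : Tm Γ ρ → Comb Γ ρ
compile (var x) = var x
compile (lam t) = abstraction (compile t)
compile (t · u) = compile t · compile u
compile Zero    = kon zero
compile Succ    = kon succ
compile Rec     = kon rec
compile Pair    = kon pair
compile Fst     = kon fst
compile Snd     = kon snd
compile Nil     = kon nil
compile Snoc    = kon snoc
compile SRec    = kon srec

S-β : (t : Tm (ρ ∷ Γ) (η ⇒ θ)) (u : Tm (ρ ∷ Γ) η) →
      Γ ∣ L ⊢ source S′ · lam t · lam u ≐ lam (t · u)
S-β {Γ = Γ} {L = L} t u = ≐trans (≐ap (β _ (lam t)) ≐refl) (≐trans
  (subst (λ w → Γ ∣ L ⊢ lam (lam (wk (wk (lam t)) · var Z · (var (S Z) · var Z))) · lam u
                      ≐ lam (w · var Z · (wk (lam u) · var Z)))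
    (trans (sub-wk (inst (lam u)) (wk (lam t))) (cong wk (inst-wk (lam u) (lam t))))
    (β _ (lam u)))
  (≐lam (≐ap (β-var t) (β-var u))))

abstraction-correct : (c : Comb (ρ ∷ Γ) η) →
                      Γ ∣ L ⊢ source (abstraction c) ≐ lam (source c)
abstraction-correct (var Z)     = ≐refl
abstraction-correct (var (S x)) = β _ _
abstraction-correct (c · d)     = ≐trans
  (≐ap (≐ap ≐refl (abstraction-correct c)) (abstraction-correct d)) (S-β (source c) (source d))
abstraction-correct {Γ = Γ} {L = L} (kon k) =
  subst (λ w → Γ ∣ L ⊢ source K′ · kon-tm k ≐ lam w) (ren-kon S k) (β _ _)
abstraction-correct I′          = β _ _
abstraction-correct K′          = β _ _
abstraction-correct S′          = β _ _

compile-correct : (t : Tm Γ ρ) → Γ ∣ L ⊢ t ≐ source (compile t)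
compile-correct (var x) = ≐refl
compile-correct (lam t) = ≐trans (≐lam (compile-correct t)) (≐sym (abstraction-correct (compile t)))
compile-correct (t · u) = ≐ap (compile-correct t) (compile-correct u)
compile-correct Zero    = ≐refl
compile-correct Succ    = ≐refl
compile-correct Rec     = ≐refl
compile-correct Pair    = ≐refl
compile-correct Fst     = ≐refl
compile-correct Snd     = ≐refl
compile-correct Nil     = ≐refl
compile-correct Snoc    = ≐refl
compile-correct SRec    = ≐refl

-- Finite sequences ordered by extension

module World (τ : Ty) where

  W : Ty
  W = τ *

  -- This is `hat` with the zero object, on which substitution is stuck for an abstract `τ`, turned
  -- into an atom.
  hatᵉ : Exp Γ (W ⇒ N ⇒ τ)
  hatᵉ = kon srec · lam (con (0ᵗ τ)) · lam (lam (lam (lam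
    (⌜ cond ⌝ · (⌜ dist ⌝ · v₀ · (⌜ len ⌝ · v₃)) · v₂ · (v₁ · v₀)))))

  -- (i + 1) ∸ |s|: the number of entries that s lacks for its entry i.
  missing : Exp Γ N → Exp Γ W → Exp Γ N
  missing i s = monus (s⁺ i) (⌜ len ⌝ · s)

  -- The prefix order, stated by entries: the entry i is present when nothing is missing for it.
  -- `query-rel` uses it in exactly this form, at a single index.
  Extends : Form (W ∷ W ∷ [])
  Extends = all N (missing v₀ v₂ ≐ O ⊃
    (missing v₀ v₁ ≐ O ∧ hatᵉ · v₁ · v₀ ≐ hatᵉ · v₂ · v₀))

  infix 15 _⊇_
  _⊇_ : Exp Γ W → Exp Γ W → Form Γ
  s' ⊇ s = pred Extends (s' ∷ s ∷ [])

  ⊇-refl : Γ ∣ Θ ⊨ all W (v₀ ⊇ v₀)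
  ⊇-refl = Λ fold Λ ƛ ⦅ h₀ , rfl ⦆

  ⊇-trans : Γ ∣ Θ ⊨ all W (all W (all W (v₀ ⊇ v₁ ⊃ v₁ ⊇ v₂ ⊃ v₀ ⊇ v₂)))
  ⊇-trans = Λ Λ Λ ƛ ƛ fold Λ ƛ cut (unfold h₁ ∙ v₀ $ h₀) (cut (unfold h₃ ∙ v₀ $ ∧-fst h₀)
    ⦅ ∧-fst h₀ , ∧-snd h₀ ⨾ ∧-snd h₁ ⦆)

  hat-snoc : Γ ∣ Θ ⊨ all W (all τ (all N (missing v₀ v₂ ≐ O ⊃
    hatᵉ · (v₂ ∷ʳ v₁) · v₀ ≐ hatᵉ · v₂ · v₀)))
  hat-snoc = Λ Λ Λ ƛ unpack use apart ∙ v₀ ∙ (⌜ len ⌝ · v₂) $ h₀ then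
    conv refl (congr (⌜ cond ⌝ · v₀ · v₃ · (hatᵉ · v₄ · v₂)) h₀)

  module Recursion (σ : Ty) where

    R Op : Ty
    R  = W ⇒ σ
    Op = R ⇒ R

    -- The value of Φ(B) at s depends on B at the sequences s * x only.
    Local : Form (Op ∷ [])
    Local = all R (all R (all W
      (all τ (v₃ · (v₁ ∷ʳ v₀) ≐ v₂ · (v₁ ∷ʳ v₀)) ⊃ v₃ · v₂ · v₀ ≐ v₃ · v₁ · v₀)))

    -- iterateᵉ Φ n K applies Φ to K until the sequence has the entry n.
    iterateᵉ : Exp Γ (Op ⇒ N ⇒ R ⇒ R)
    iterateᵉ = lam (lam (lam (lam
      (kon rec · v₁ · lam (lam (v₅ · v₀)) · missing v₂ v₀ · v₀))))

    -- No induction is needed: missing n (s * x) computes to the predecessor of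
    -- missing n s, so unfolding one step of the iteration at s suffices.
    iterate-fixed : Γ ∣ Θ ⊨ all Op (all N (all R (all W (pred Local (v₃ ∷ []) ⊃
      (missing v₂ v₀ ≐ O ⊃ v₁ · v₀ ≐ v₃ · v₁ · v₀) ⊃
      iterateᵉ · v₃ · v₂ · v₁ · v₀ ≐ v₃ · (iterateᵉ · v₃ · v₂ · v₁) · v₀))))
    iterate-fixed = Λ Λ Λ Λ ƛ ƛ
      cases (missing v₃ v₁ ≐ v₀ ⊃ iterateᵉ · v₄ · v₃ · v₂ · v₁ ≐ v₄ · (iterateᵉ · v₄ · v₃ · v₂) · v₁)
        (ƛ (conv refl (congr (kon rec · v₂ · lam (lam (v₆ · v₀)) · v₀ · v₁) h₀)
          ⨾ (h₁ $ h₀)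
          -- If nothing is missing at s, then nothing is missing at s * x, where the iteration is
          -- thus K as well; locality exchanges the two under Φ.
          ⨾ (unfold h₂ ∙ v₁ ∙ (iterateᵉ · v₃ · v₂ · v₁) ∙ v₀ $ (Λ
              conv refl (congr (kon rec · v₃ · lam (lam (v₇ · v₀)) · (predᵉ · v₀) · (v₂ ∷ʳ v₁))
                (symm h₀))))))
        (ƛ (conv refl (congr (kon rec · v₃ · lam (lam (v₇ · v₀)) · v₀ · v₂) h₀)
          ⨾ (unfold h₃ ∙ (kon rec · v₂ · lam (lam (v₆ · v₀)) · v₀) ∙ (iterateᵉ · v₄ · v₃ · v₂) ∙ v₁ $ (Λ
              conv refl (congr (kon rec · v₄ · lam (lam (v₈ · v₀)) · (predᵉ · v₀) · (v₃ ∷ʳ v₁))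
                (symm h₀))))))
       ∙ missing v₂ v₀ $ rfl

    -- Continuation-passing translation.  A value of type N becomes a functional
    -- that turns a family of candidates B : R, indexed by the possible values,
    -- into one candidate.

    M : Ty → Ty
    M X = (X ⇒ R) ⇒ R

    ⟦_⟧ : Ty → Ty
    ⟦ N ⟧     = M N
    ⟦ ρ ⇒ η ⟧ = ⟦ ρ ⟧ ⇒ ⟦ η ⟧
    ⟦ ρ ⊗ η ⟧ = ⟦ ρ ⟧ ⊗ ⟦ η ⟧
    ⟦ ρ * ⟧   = M (⟦ ρ ⟧ *)

    -- Values of type ρ depending on a sequence s are functions y : W ⇒ ρ.  A
    -- formula V in v, y, s, Φ says that v represents y at all extensions of s.
    -- Base V in d, y, Φ: if the candidates C v are fixed points of Φ at each
    -- s' ⊇ s where v represents y, then d C is a fixed point of Φ at s.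
    Base : ∀ {X A} → Form (A ∷ W ⇒ X ∷ W ∷ Op ∷ []) → Form (M A ∷ W ⇒ X ∷ Op ∷ [])
    Base {A = A} V = all W (all (A ⇒ R)
      (all W (all A (v₁ ⊇ v₃ ⊃ pred V (v₀ ∷ v₅ ∷ v₁ ∷ v₆ ∷ []) ⊃
        v₂ · v₀ · v₁ ≐ v₆ · (v₂ · v₀) · v₁))
      ⊃ v₂ · v₀ · v₁ ≐ v₄ · (v₂ · v₀) · v₁))

    Value : (X : Ty) → Form (X ∷ W ⇒ X ∷ W ∷ Op ∷ [])
    Value X = all W (v₀ ⊇ v₃ ⊃ v₂ · v₀ ≐ v₁)

    -- A list of translated entries, each with the function of s that it represents.
    Entries : Ty → Ty
    Entries ρ = (⟦ ρ ⟧ ⊗ (W ⇒ ρ)) *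

    representatives : Exp Γ (Entries ρ ⇒ ⟦ ρ ⟧ *)
    representatives = kon srec · kon nil · lam (lam (lam (v₀ ∷ʳ π₁ v₁)))

    evaluate : Exp Γ (W ⇒ Entries ρ ⇒ ρ *)
    evaluate = lam (kon srec · kon nil · lam (lam (lam (v₀ ∷ʳ (π₂ v₁ · v₃)))))

    Entry : Form (⟦ ρ ⟧ ∷ W ⇒ ρ ∷ Op ∷ []) → Form (⟦ ρ ⟧ ⊗ (W ⇒ ρ) ∷ Op ∷ [])
    Entry Q = pred Q (π₁ v₀ ∷ π₂ v₀ ∷ v₁ ∷ [])

    -- `Rel ρ` relates an entry to a function of s, so the list y(s) alone does not say what the
    -- entries represent. A paired list supplies these functions, and y has to agree with their
    -- values on all extensions of s.
    ListValue : Form (⟦ ρ ⟧ ∷ W ⇒ ρ ∷ Op ∷ []) → Form (⟦ ρ ⟧ * ∷ W ⇒ ρ * ∷ W ∷ Op ∷ [])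
    ListValue {ρ} Q = ex (Entries ρ)
      ( pred (Every (Entry Q)) (v₀ ∷ v₄ ∷ [])
      ∧ v₁ ≐ representatives · v₀
      ∧ all W (v₀ ⊇ v₄ ⊃ v₃ · v₀ ≐ evaluate · v₀ · v₁))

    Rel : (ρ : Ty) → Form (⟦ ρ ⟧ ∷ W ⇒ ρ ∷ Op ∷ [])
    Rel N       = Base (Value N)
    Rel (ρ ⇒ η) = all ⟦ ρ ⟧ (all (W ⇒ ρ) (pred (Rel ρ) (v₁ ∷ v₀ ∷ v₄ ∷ []) ⊃
                    pred (Rel η) (v₂ · v₁ ∷ lam (v₄ · v₀ · (v₁ · v₀)) ∷ v₄ ∷ [])))
    Rel (ρ ⊗ η) = pred (Rel ρ) (π₁ v₀ ∷ lam (π₁ (v₂ · v₀)) ∷ v₂ ∷ [])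
                ∧ pred (Rel η) (π₂ v₀ ∷ lam (π₂ (v₂ · v₀)) ∷ v₂ ∷ [])
    Rel (ρ *)   = Base (ListValue (Rel ρ))

    -- A stage of `bind` yields a function that agrees with the intended g only above some s; this
    -- closure property turns what represents the former into what represents g.
    Respects : ∀ {X A} → Form (A ∷ W ⇒ X ∷ W ∷ Op ∷ []) → Form Γ
    Respects {X = X} {A} V = all Op (all W (all (W ⇒ X) (all (W ⇒ X) (all A
      (pred V (v₀ ∷ v₂ ∷ v₃ ∷ v₄ ∷ []) ⊃ all W (v₀ ⊇ v₄ ⊃ v₃ · v₀ ≐ v₂ · v₀) ⊃
       pred V (v₀ ∷ v₁ ∷ v₃ ∷ v₄ ∷ []))))))

    value-respects : ∀ {X} → Γ ∣ Θ ⊨ Respects (Value X)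
    value-respects = Λ Λ Λ Λ Λ ƛ ƛ
      fold Λ ƛ (symm (h₁ ∙ v₀ $ h₀) ⨾ (unfold h₂ ∙ v₀ $ h₀))

    list-respects : {Q : Form (⟦ ρ ⟧ ∷ W ⇒ ρ ∷ Op ∷ [])} → Γ ∣ Θ ⊨ Respects (ListValue Q)
    list-respects = Λ Λ Λ Λ Λ ƛ ƛ
      unpack (unfold h₁) then fold pack v₀ ▹
      ⦅ ∧-fst h₀ , ⦅ ∧-fst (∧-snd h₀) , Λ ƛ (symm (h₂ ∙ v₀ $ h₀) ⨾ (∧-snd (∧-snd h₁) ∙ v₀ $ h₀)) ⦆ ⦆

    -- The continuation monad and the relation

    unit : ∀ {X} → Exp Γ (X ⇒ M X)
    unit = lam (lam (v₀ · v₁))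

    unit-base : ∀ {X A} (V : Form (A ∷ W ⇒ X ∷ W ∷ Op ∷ [])) → Γ ∣ Θ ⊨ all Op (all (W ⇒ X) (all A
      (all W (pred V (v₁ ∷ v₂ ∷ v₀ ∷ v₃ ∷ [])) ⊃ pred (Base V) (unit · v₀ ∷ v₁ ∷ v₂ ∷ []))))
    unit-base V = Λ Λ Λ ƛ fold Λ Λ ƛ
      conv refl (h₀ ∙ v₁ ∙ v₂ $ use ⊇-refl ∙ v₁ $ (h₁ ∙ v₁))

    -- Kleisli extension for the continuation monad.
    bind : ∀ {X A} → Exp Γ ((X ⇒ M A) ⇒ M X ⇒ M A)
    bind = lam (lam (lam (v₁ · lam (v₃ · v₀ · v₁))))

    -- In F, y, g, Φ: whenever v represents y above s, F v is related by Q to a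
    -- function that agrees with g above s.
    Stage : ∀ {X A B} → Form (A ∷ W ⇒ X ∷ W ∷ Op ∷ []) → Form (B ∷ W ⇒ ρ ∷ Op ∷ []) →
            Form (A ⇒ B ∷ W ⇒ X ∷ W ⇒ ρ ∷ Op ∷ [])
    Stage {ρ} {A = A} V Q = all A (all W (pred V (v₁ ∷ v₃ ∷ v₀ ∷ v₅ ∷ []) ⊃
      ex (W ⇒ ρ) (pred Q (v₃ · v₂ ∷ v₀ ∷ v₆ ∷ []) ∧ all W (v₀ ⊇ v₂ ⊃ v₁ · v₀ ≐ v₆ · v₀))))

    Extension : ∀ {X A B} → Form (A ∷ W ⇒ X ∷ W ∷ Op ∷ []) → Form (B ∷ W ⇒ ρ ∷ Op ∷ []) →
                Form ((A ⇒ B) ⇒ M A ⇒ B ∷ [])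
    Extension {ρ} {X = X} {A} {B} V Q = all Op (all (W ⇒ ρ) (all (W ⇒ X) (all (M A) (all (A ⇒ B)
      (pred (Base V) (v₁ ∷ v₂ ∷ v₄ ∷ []) ⊃ pred (Stage V Q) (v₀ ∷ v₂ ∷ v₃ ∷ v₄ ∷ []) ⊃
       pred Q (v₅ · v₀ · v₁ ∷ v₃ ∷ v₄ ∷ []))))))

    -- For candidates C, the relation for d is applied to the candidates F(v)(C). Where v represents
    -- y, F(v) is related to a function agreeing with g from there on, so F(v)(C) is a fixed point
    -- there as soon as the C(w) are, wherever w represents g.
    bind-extension : ∀ {X A Y B} (V : Form (A ∷ W ⇒ X ∷ W ∷ Op ∷ []))
      (V' : Form (B ∷ W ⇒ Y ∷ W ∷ Op ∷ [])) →
      (∀ {Γ} {Θ : Hyps Γ} → Γ ∣ Θ ⊨ Respects V') → Γ ∣ Θ ⊨ pred (Extension V (Base V')) (bind ∷ [])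
    bind-extension V V' respects =
      fold Λ Λ Λ Λ Λ ƛ ƛ
      fold Λ Λ ƛ conv refl (unfold h₂ ∙ v₁ ∙ lam (v₃ · v₀ · v₁) $
        (Λ Λ ƛ ƛ unpack (unfold h₃ ∙ v₀ ∙ v₁ $ h₀) then
          conv refl (unfold (∧-fst h₀) ∙ v₂ ∙ v₃ $
            (Λ Λ ƛ ƛ
              (h₅ ∙ v₁ ∙ v₀ $ (use ⊇-trans ∙ v₆ ∙ v₄ ∙ v₁ $ h₁ $ h₄) $
                (use respects ∙ v₁₁ ∙ v₁ ∙ v₂ ∙ v₁₀ ∙ v₀ $ h₀ $
                  (Λ ƛ (∧-snd h₃ ∙ v₀ $ (use ⊇-trans ∙ v₅ ∙ v₂ ∙ v₀ $ h₀ $ h₂)))))))))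

    ext-def : ∀ X (ρ : Ty) → Exp [] ((X ⇒ ⟦ ρ ⟧) ⇒ M X ⇒ ⟦ ρ ⟧)
    ext-def X N       = bind
    ext-def X (ρ ⇒ η) = lam (lam (lam (con (tm (ext-def X η)) · lam (v₃ · v₀ · v₁) · v₁)))
    ext-def X (ρ ⊗ η) = lam (lam ⟪ con (tm (ext-def X ρ)) · lam (π₁ (v₂ · v₀)) · v₀
                                 , con (tm (ext-def X η)) · lam (π₂ (v₂ · v₀)) · v₀ ⟫)
    ext-def X (ρ *)   = bind

    extend-to : ∀ {X} (ρ : Ty) → Exp Γ ((X ⇒ ⟦ ρ ⟧) ⇒ M X ⇒ ⟦ ρ ⟧)
    extend-to {X = X} ρ = con (tm (ext-def X ρ))

    -- Induction on the type of the results, with `bind` at `N` and at sequences. At an arrow the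
    -- argument is held fixed and each stage function is applied pointwise to the argument's
    -- function of s; at a product the stage functions are projected.
    extend-extension : ∀ {X A} (V : Form (A ∷ W ⇒ X ∷ W ∷ Op ∷ [])) (ρ : Ty) →
                       Γ ∣ Θ ⊨ pred (Extension V (Rel ρ)) (extend-to ρ ∷ [])
    extend-extension V N = replace (pred (Extension V (Rel N)) (v₀ ∷ [])) (symm (unfold-con bind))
      (use (bind-extension V (Value N) value-respects))
    extend-extension V (ρ *) = replace (pred (Extension V (Rel (ρ *))) (v₀ ∷ []))
      (symm (unfold-con bind)) (use (bind-extension V (ListValue (Rel ρ)) list-respects))
    extend-extension {A = A} V (ρ ⇒ η) = replace (pred (Extension V (Rel (ρ ⇒ η))) (v₀ ∷ []))
      (symm (unfold-con (ext-def A (ρ ⇒ η))))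
      (fold Λ Λ Λ Λ Λ ƛ ƛ fold Λ Λ ƛ conv refl
        (unfold (use (extend-extension V η)) ∙ v₆ ∙ lam (v₆ · v₀ · (v₁ · v₀)) ∙ v₄ ∙ v₃
          ∙ lam (v₃ · v₀ · v₂)
          $ h₂ $ (fold Λ Λ ƛ unpack unfold h₂ ∙ v₁ ∙ v₀ $ h₀ then
            pack lam (v₁ · v₀ · (v₄ · v₀)) ▹
              ⦅ conv refl (unfold (∧-fst h₀) ∙ v₄ ∙ v₃ $ h₂)
              , Λ ƛ conv refl (congr (v₀ · (v₅ · v₁)) (∧-snd h₁ ∙ v₀ $ h₀)) ⦆)))
    extend-extension {A = A} V (ρ ⊗ η) = replace (pred (Extension V (Rel (ρ ⊗ η))) (v₀ ∷ []))
      (symm (unfold-con (ext-def A (ρ ⊗ η))))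
      (fold Λ Λ Λ Λ Λ ƛ ƛ fold
        ⦅ conv refl
          (unfold (use (extend-extension V ρ)) ∙ v₄ ∙ lam (π₁ (v₄ · v₀)) ∙ v₂ ∙ v₁ ∙ lam (π₁ (v₁ · v₀))
            $ h₁ $ (fold Λ Λ ƛ unpack unfold h₁ ∙ v₁ ∙ v₀ $ h₀ then
              pack lam (π₁ (v₁ · v₀)) ▹
                ⦅ conv refl (∧-fst (unfold (∧-fst h₀)))
                , Λ ƛ conv refl (congr (kon fst · v₀) (∧-snd h₁ ∙ v₀ $ h₀)) ⦆))
        , conv refl
          (unfold (use (extend-extension V η)) ∙ v₄ ∙ lam (π₂ (v₄ · v₀)) ∙ v₂ ∙ v₁ ∙ lam (π₂ (v₁ · v₀))
            $ h₁ $ (fold Λ Λ ƛ unpack unfold h₁ ∙ v₁ ∙ v₀ $ h₀ then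
              pack lam (π₂ (v₁ · v₀)) ▹
                ⦅ conv refl (∧-snd (unfold (∧-fst h₀)))
                , Λ ƛ conv refl (congr (kon snd · v₀) (∧-snd h₁ ∙ v₀ $ h₀)) ⦆)) ⦆)

    constant-rel : ∀ X → Γ ∣ Θ ⊨ all Op (all X (pred (Base (Value X)) (unit · v₀ ∷ lam v₁ ∷ v₁ ∷ [])))
    constant-rel X = Λ Λ use (unit-base (Value X)) ∙ v₁ ∙ lam v₁ ∙ v₀ $ (Λ fold Λ ƛ compute)

    list-rel : (ρ : Ty) → Γ ∣ Θ ⊨ all Op (all (Entries ρ) (pred (Every (Entry (Rel ρ))) (v₀ ∷ v₁ ∷ []) ⊃
      pred (Rel (ρ *)) (unit · (representatives · v₀) ∷ lam (evaluate · v₀ · v₁) ∷ v₁ ∷ [])))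
    list-rel ρ = Λ Λ ƛ use (unit-base (ListValue (Rel ρ))) ∙ v₁ ∙ lam (evaluate · v₀ · v₁)
      ∙ (representatives · v₀)
      $ (Λ fold pack v₁ ▹ ⦅ h₀ , ⦅ rfl , Λ ƛ compute ⦆ ⦆)

    -- The translations of the constants and of the combinators

    I-rel : Γ ∣ Θ ⊨ all Op (pred (Rel (ρ ⇒ ρ)) (lam v₀ ∷ lam (lam v₀) ∷ v₀ ∷ []))
    I-rel = Λ fold Λ Λ ƛ conv refl h₀

    K-rel : Γ ∣ Θ ⊨ all Op (pred (Rel (ρ ⇒ η ⇒ ρ)) (lam (lam v₁) ∷ lam (lam (lam v₁)) ∷ v₀ ∷ []))
    K-rel = Λ fold Λ Λ ƛ fold Λ Λ ƛ conv refl h₁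

    Sᵉ : Exp Γ ((ρ ⇒ η ⇒ θ) ⇒ (ρ ⇒ η) ⇒ ρ ⇒ θ)
    Sᵉ = lam (lam (lam (v₂ · v₀ · (v₁ · v₀))))

    S-rel : Γ ∣ Θ ⊨ all Op (pred (Rel ((ρ ⇒ η ⇒ θ) ⇒ (ρ ⇒ η) ⇒ ρ ⇒ θ)) (Sᵉ ∷ lam Sᵉ ∷ v₀ ∷ []))
    S-rel = Λ fold Λ Λ ƛ fold Λ Λ ƛ fold Λ Λ ƛ conv refl
      (unfold (unfold h₂ ∙ v₁ ∙ v₀ $ h₀) ∙ (v₃ · v₁) ∙ lam (v₃ · v₀ · (v₁ · v₀))
        $ (unfold h₁ ∙ v₁ ∙ v₀ $ h₀))

    zero-rel : Γ ∣ Θ ⊨ all Op (pred (Rel N) (unit · O ∷ lam O ∷ v₀ ∷ []))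
    zero-rel = Λ use (constant-rel N) ∙ v₀ ∙ O

    succᵗ : Exp Γ (⟦ N ⟧ ⇒ ⟦ N ⟧)
    succᵗ = lam (extend-to N · lam (unit · s⁺ v₀) · v₀)

    succ-rel : Γ ∣ Θ ⊨ all Op (pred (Rel (N ⇒ N)) (succᵗ ∷ lam (kon succ) ∷ v₀ ∷ []))
    succ-rel = Λ fold Λ Λ ƛ conv refl
      (unfold (use (extend-extension (Value N) N)) ∙ v₂ ∙ lam (s⁺ (v₁ · v₀)) ∙ v₀ ∙ v₁
        ∙ lam (unit · s⁺ v₀) $ h₀ $
        -- Above the current sequence the argument has one fixed value, so a constant function can
        -- stand for its successor.
        (fold Λ Λ ƛ pack lam (s⁺ v₂) ▹ ⦅ conv refl (use (constant-rel N) ∙ v₄ ∙ s⁺ v₁)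
          , Λ ƛ conv refl (congr (s⁺ v₀) (symm (unfold h₁ ∙ v₀ $ h₀))) ⦆))

    recᵗ : Exp Γ (⟦ ρ ⟧ ⇒ (⟦ N ⟧ ⇒ ⟦ ρ ⟧ ⇒ ⟦ ρ ⟧) ⇒ ⟦ N ⟧ ⇒ ⟦ ρ ⟧)
    recᵗ {ρ = ρ} = lam (lam (lam (extend-to ρ · (kon rec · v₂ · lam (v₂ · (unit · v₀))) · v₀)))

    -- For a plain number m the claim is an induction on m, with m entering the step function as
    -- `unit`; `extend-extension` carries it over to continuations.
    rec-rel : Γ ∣ Θ ⊨ all Op (pred (Rel (ρ ⇒ (N ⇒ ρ ⇒ ρ) ⇒ N ⇒ ρ)) (recᵗ ∷ lam (kon rec) ∷ v₀ ∷ []))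
    rec-rel {ρ = ρ} = Λ fold Λ Λ ƛ fold Λ Λ ƛ fold Λ Λ ƛ cut
      (induction (pred (Rel ρ) (kon rec · v₆ · lam (v₅ · (unit · v₀)) · v₀
          ∷ lam (kon rec · (v₆ · v₀) · (v₄ · v₀) · v₁) ∷ v₇ ∷ []))
        (conv refl h₂)
        (Λ ƛ conv refl (unfold (unfold h₂ ∙ (unit · v₀) ∙ lam v₁ $ (use (constant-rel N) ∙ v₇ ∙ v₀))
          ∙ (kon rec · v₆ · lam (v₅ · (unit · v₀)) · v₀) ∙ lam (kon rec · (v₆ · v₀) · (v₄ · v₀) · v₁)
          $ h₀)))
      (conv refl (unfold (use (extend-extension (Value N) ρ)) ∙ v₆
        ∙ lam (kon rec · (v₅ · v₀) · (v₃ · v₀) · (v₁ · v₀))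
        ∙ v₀ ∙ v₁ ∙ (kon rec · v₅ · lam (v₄ · (unit · v₀))) $ h₁ $
          (fold Λ Λ ƛ pack lam (kon rec · (v₇ · v₀) · (v₅ · v₀) · v₂) ▹ ⦅ conv refl (h₁ ∙ v₁)
            , Λ ƛ conv refl (congr (kon rec · (v₈ · v₁) · (v₆ · v₁) · v₀)
            (symm (unfold h₁ ∙ v₀ $ h₀))) ⦆)))

    pair-rel : Γ ∣ Θ ⊨ all Op (pred (Rel (ρ ⇒ η ⇒ ρ ⊗ η)) (kon pair ∷ lam (kon pair) ∷ v₀ ∷ []))
    pair-rel = Λ fold Λ Λ ƛ fold Λ Λ ƛ fold ⦅ conv refl h₁ , conv refl h₀ ⦆

    fst-rel : Γ ∣ Θ ⊨ all Op (pred (Rel (ρ ⊗ η ⇒ ρ)) (kon fst ∷ lam (kon fst) ∷ v₀ ∷ []))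
    fst-rel = Λ fold Λ Λ ƛ conv refl (∧-fst (unfold h₀))

    snd-rel : Γ ∣ Θ ⊨ all Op (pred (Rel (ρ ⊗ η ⇒ η)) (kon snd ∷ lam (kon snd) ∷ v₀ ∷ []))
    snd-rel = Λ fold Λ Λ ƛ conv refl (∧-snd (unfold h₀))

    nil-rel : Γ ∣ Θ ⊨ all Op (pred (Rel (ρ *)) (unit · kon nil ∷ lam (kon nil) ∷ v₀ ∷ []))
    nil-rel {ρ = ρ} = Λ conv refl (use (list-rel ρ) ∙ v₀ ∙ kon nil
      $ (use (every-nil (Entry (Rel ρ))) ∙ v₀))

    snocᵗ : Exp Γ (⟦ ρ * ⟧ ⇒ ⟦ ρ ⟧ ⇒ ⟦ ρ * ⟧)
    snocᵗ {ρ = ρ} = lam (lam (extend-to (ρ *) · lam (unit · (v₀ ∷ʳ v₁)) · v₁))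

    snoc-rel : Γ ∣ Θ ⊨ all Op (pred (Rel (ρ * ⇒ ρ ⇒ ρ *)) (snocᵗ ∷ lam (kon snoc) ∷ v₀ ∷ []))
    snoc-rel {ρ = ρ} = Λ fold Λ Λ ƛ fold Λ Λ ƛ conv refl
      (unfold (use (extend-extension (ListValue (Rel ρ)) (ρ *))) ∙ v₄ ∙ lam (v₃ · v₀ ∷ʳ v₁ · v₀) ∙ v₂
        ∙ v₃
        ∙ lam (unit · (v₀ ∷ʳ v₂)) $ h₁ $
          -- The new entry is paired with its own function of s, which keeps the result a list of
          -- related pairs.
          (fold Λ Λ ƛ unpack unfold h₀ then pack lam (evaluate · v₀ · (v₁ ∷ʳ ⟪ v₅ , v₄ ⟫)) ▹
            ⦅ conv refl (replace (pred (Rel (ρ *))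
              (unit · (v₀ ∷ʳ v₅) ∷ lam (evaluate · v₀ · (v₂ ∷ʳ ⟪ v₆ , v₅ ⟫)) ∷ v₈ ∷ []))
                (symm (∧-fst (∧-snd h₀))) (conv refl (use (list-rel ρ) ∙ v₇ ∙ (v₀ ∷ʳ ⟪ v₄ , v₃ ⟫) $
                  (use (every-snoc (Entry (Rel ρ))) ∙ v₇ ∙ v₀ ∙ ⟪ v₄ , v₃ ⟫ $ ∧-fst h₀
                    $ (fold conv refl h₂)))))
            , Λ ƛ conv refl (congr (v₀ ∷ʳ v₅ · v₁) (symm (∧-snd (∧-snd h₁) ∙ v₀ $ h₀))) ⦆))

    srecᵗ : Exp Γ (⟦ η ⟧ ⇒ (⟦ ρ * ⟧ ⇒ ⟦ ρ ⟧ ⇒ ⟦ η ⟧ ⇒ ⟦ η ⟧) ⇒ ⟦ ρ * ⟧ ⇒ ⟦ η ⟧)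
    srecᵗ {η = η} = lam (lam (lam (extend-to η · (kon srec · v₂ · lam (v₂ · (unit · v₀))) · v₀)))

    -- As for `rec-rel`, but the induction runs over the paired list: the step function consumes
    -- entries and needs to know what each of them represents.
    srec-rel : Γ ∣ Θ ⊨ all Op (pred (Rel (η ⇒ (ρ * ⇒ ρ ⇒ η ⇒ η) ⇒ ρ * ⇒ η))
      (srecᵗ ∷ lam (kon srec) ∷ v₀ ∷ []))
    srec-rel {η = η} {ρ = ρ} = Λ fold Λ Λ ƛ fold Λ Λ ƛ fold Λ Λ ƛ cut
      (list-induction (pred (Every (Entry (Rel ρ))) (v₀ ∷ v₇ ∷ []) ⊃
          pred (Rel η) (kon srec · v₆ · lam (v₅ · (unit · v₀)) · (representatives · v₀)
            ∷ lam (kon srec · (v₆ · v₀) · (v₄ · v₀) · (evaluate · v₀ · v₁)) ∷ v₇ ∷ []))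
        (ƛ conv refl h₃)
        (Λ Λ ƛ ƛ cut (use (every-init (Entry (Rel ρ))) ∙ v₈ ∙ v₁ ∙ v₀ $ h₀) (conv refl
          (unfold (unfold (unfold h₄ ∙ (unit · (representatives · v₁)) ∙ lam (evaluate · v₀ · v₂)
            $ (use (list-rel ρ) ∙ v₈ ∙ v₁ $ h₀))
              ∙ π₁ v₀ ∙ π₂ v₀ $ unfold (use (every-last (Entry (Rel ρ))) ∙ v₈ ∙ v₁ ∙ v₀ $ h₁))
            ∙ (kon srec · v₇ · lam (v₆ · (unit · v₀)) · (representatives · v₁))
            ∙ lam (kon srec · (v₇ · v₀) · (v₅ · v₀) · (evaluate · v₀ · v₂)) $ (h₂ $ h₀)))))
      (conv refl (unfold (use (extend-extension (ListValue (Rel ρ)) η)) ∙ v₆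
        ∙ lam (kon srec · (v₅ · v₀) · (v₃ · v₀) · (v₁ · v₀)) ∙ v₀ ∙ v₁
        ∙ (kon srec · v₅ · lam (v₄ · (unit · v₀))) $ h₁ $
          (fold Λ Λ ƛ unpack unfold h₀ then pack lam
            (kon srec · (v₈ · v₀) · (v₆ · v₀) · (evaluate · v₀ · v₁)) ▹
            ⦅ conv refl (replace (pred (Rel η) (kon srec · v₉ · lam (v₈ · (unit · v₀)) · v₀
                  ∷ lam (kon srec · (v₉ · v₀) · (v₇ · v₀) · (evaluate · v₀ · v₂)) ∷ v₁₀ ∷ []))
                (symm (∧-fst (∧-snd h₀))) (conv refl (h₂ ∙ v₀ $ ∧-fst h₀)))
            , Λ ƛ conv refl (congr (kon srec · (v₉ · v₁) · (v₇ · v₁) · v₀)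
            (symm (∧-snd (∧-snd h₁) ∙ v₀ $ h₀))) ⦆)))

    -- The fundamental lemma for closed combinatory terms

    target : Comb [] ρ → Exp [] ⟦ ρ ⟧
    target (var ())
    target (c · d)    = target c · target d
    target (kon zero) = unit · O
    target (kon succ) = succᵗ
    target (kon rec)  = recᵗ
    target (kon pair) = kon pair
    target (kon fst)  = kon fst
    target (kon snd)  = kon snd
    target (kon nil)  = unit · kon nil
    target (kon snoc) = snocᵗ
    target (kon srec) = srecᵗ
    target I′         = lam v₀
    target K′         = lam (lam v₁)
    target S′         = Sᵉ

    Represents : Exp [] ⟦ ρ ⟧ → Tm [] ρ → Form Γ
    Represents {ρ} d e = all Op (pred (Rel ρ) (con (tm d) ∷ lam (con e) ∷ v₀ ∷ []))

    -- The relations above are proved for transparent expressions, while `Represents` speaks of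
    -- atoms. Both denote the same terms, so the formulas agree after `fm`.
    represents-closed : (d : Exp [] ⟦ ρ ⟧) (e : Exp [] ρ) →
      Γ ∣ Θ ⊨ all Op (pred (Rel ρ) (renₑ closing d ∷ lam (renₑ closing e) ∷ v₀ ∷ [])) →
        Γ ∣ Θ ⊨ Represents d (tm e)
    represents-closed {ρ} d e = recast (cong (all Op) (subF-cong
      (λ { Z → tm-closing d ; (S Z) → cong lam (tm-closing e) ; (S (S Z)) → refl }) (fm (Rel ρ))))

    represents : (c : Comb [] ρ) → Γ ∣ Θ ⊨ Represents (target c) (source c)
    represents (var ())
    represents {ρ} (c · d) = Λ recast {ψ = pred (Rel ρ)
        (con (tm (target c)) · con (tm (target d)) ∷ lam (con (source c) · con (source d)) ∷ v₀ ∷ [])}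
      (subF-cong (λ { Z → refl ; (S Z) → refl ; (S (S Z)) → refl }) (fm (Rel ρ)))
      (conv refl (unfold (use (represents c) ∙ v₀) ∙ con (tm (target d)) ∙ lam (con (source d))
        $ (use (represents d) ∙ v₀)))
    represents (kon zero) = represents-closed (unit · O) O zero-rel
    represents (kon succ) = represents-closed succᵗ (kon succ) succ-rel
    represents (kon rec)  = represents-closed recᵗ (kon rec) rec-rel
    represents (kon pair) = represents-closed (kon pair) (kon pair) pair-rel
    represents (kon fst)  = represents-closed (kon fst) (kon fst) fst-rel
    represents (kon snd)  = represents-closed (kon snd) (kon snd) snd-rel
    represents (kon nil)  = represents-closed (unit · kon nil) (kon nil) nil-rel
    represents (kon snoc) = represents-closed snocᵗ (kon snoc) snoc-rel
    represents (kon srec) = represents-closed srecᵗ (kon srec) srec-rel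
    represents I′         = represents-closed (lam v₀) (lam v₀) I-rel
    represents K′         = represents-closed (lam (lam v₁)) (lam (lam v₁)) K-rel
    represents S′         = represents-closed Sᵉ Sᵉ S-rel

    -- Types of level 0 and 1

    run : (ρ : Ty) → Exp [] (⟦ ρ ⟧ ⇒ M ρ)

    run-to : (ρ : Ty) → Exp Γ (⟦ ρ ⟧ ⇒ M ρ)
    run-to ρ = con (tm (run ρ))

    -- Traversal of a list in the monad `M`.
    collect : (ρ : Ty) → Exp Γ (⟦ ρ ⟧ * ⇒ M (ρ *))
    collect ρ = kon srec · (unit · kon nil) · lam (lam (lam
      (bind · lam (bind · lam (unit · (v₁ ∷ʳ v₀)) · (run-to ρ · v₂)) · v₀)))

    run N       = lam v₀
    -- No arrow has level 0, so the zero object is a mere filler here.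
    run (ρ ⇒ η) = lam (unit · con (0ᵗ (ρ ⇒ η)))
    run (ρ ⊗ η) = lam (bind · lam (bind · lam (unit · ⟪ v₁ , v₀ ⟫) · (run-to η · π₂ v₁)) ·
      (run-to ρ · π₁ v₀))
    run (ρ *)   = lam (bind · collect ρ · v₀)

    Runs : (ρ : Ty) → Form (⟦ ρ ⟧ ⇒ M ρ ∷ [])
    Runs ρ = all Op (all (W ⇒ ρ) (all ⟦ ρ ⟧
      (pred (Rel ρ) (v₀ ∷ v₁ ∷ v₂ ∷ []) ⊃ pred (Base (Value ρ)) (v₃ · v₀ ∷ v₁ ∷ v₂ ∷ []))))

    -- An object of level 0 is built from numbers by pairs and sequences only, so running its
    -- components one after another delivers its plain value.
    runs : (ρ : Ty) → level ρ ≤ 0 → Γ ∣ Θ ⊨ pred (Runs ρ) (run-to ρ ∷ [])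
    runs N l = replace (pred (Runs N) (v₀ ∷ [])) (symm (unfold-con (run N))) (fold Λ Λ Λ ƛ conv refl h₀)
    runs (ρ ⇒ η) l = contradiction (≤-trans (m≤m⊔n (suc (level ρ)) (level η)) l) λ ()
    runs (ρ ⊗ η) l = replace (pred (Runs (ρ ⊗ η)) (v₀ ∷ [])) (symm (unfold-con (run (ρ ⊗ η))))
      (fold Λ Λ Λ ƛ conv refl
      (unfold (use (bind-extension (Value ρ) (Value (ρ ⊗ η)) value-respects)) ∙ v₂ ∙ v₁
        ∙ lam (π₁ (v₂ · v₀)) ∙ (run-to ρ · π₁ v₀)
        ∙ lam (bind · lam (unit · ⟪ v₁ , v₀ ⟫) · (run-to η · π₂ v₁))
        $ (unfold (use (runs ρ (≤-trans (m≤m⊔n (level ρ) (level η)) l))) ∙ v₂ ∙ lam (π₁ (v₂ · v₀))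
        ∙ π₁ v₀ $ ∧-fst (unfold h₀))
        -- The first component has already been delivered and is constant; the second still depends
        -- on s.
        $ (fold Λ Λ ƛ pack lam ⟪ v₂ , π₂ (v₄ · v₀) ⟫ ▹
          ⦅ conv refl (unfold (use (bind-extension (Value η) (Value (ρ ⊗ η)) value-respects)) ∙ v₄
            ∙ lam ⟪ v₂ , π₂ (v₄ · v₀) ⟫
              ∙ lam (π₂ (v₄ · v₀)) ∙ (run-to η · π₂ v₂) ∙ lam (unit · ⟪ v₂ , v₀ ⟫)
              $ (unfold (use (runs η (≤-trans (m≤n⊔m (level ρ) (level η)) l))) ∙ v₄
              ∙ lam (π₂ (v₄ · v₀)) ∙ π₂ v₂ $ ∧-snd (unfold h₁))
              $ (fold Λ Λ ƛ pack lam ⟪ v₄ , v₂ ⟫ ▹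
                ⦅ conv refl (use (constant-rel (ρ ⊗ η)) ∙ v₆ ∙ ⟪ v₃ , v₁ ⟫)
                , Λ ƛ conv refl (congr ⟪ v₅ , v₀ ⟫ (symm (unfold h₁ ∙ v₀ $ h₀))) ⦆))
          , Λ ƛ (conv refl (congr ⟪ v₀ , π₂ (v₅ · v₁) ⟫ (symm (unfold h₁ ∙ v₀ $ h₀)))
          ⨾ surj (v₄ · v₀)) ⦆)))
    runs (ρ *) l = replace (pred (Runs (ρ *)) (v₀ ∷ [])) (symm (unfold-con (run (ρ *))))
      (fold Λ Λ Λ ƛ cut
      (list-induction (pred (Every (Entry (Rel ρ))) (v₀ ∷ v₃ ∷ []) ⊃
          pred (Base (Value (ρ *))) (collect ρ · (representatives · v₀) ∷ lam (evaluate · v₀ · v₁) ∷ v₃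
            ∷ []))
        (ƛ conv refl (use (constant-rel (ρ *)) ∙ v₂ ∙ kon nil))
        (Λ Λ ƛ ƛ conv refl (unfold (use (bind-extension (Value (ρ *)) (Value (ρ *)) value-respects))
          ∙ v₄
          ∙ lam (evaluate · v₀ · (v₂ ∷ʳ v₁)) ∙ lam (evaluate · v₀ · v₂)
          ∙ (collect ρ · (representatives · v₁))
          ∙ lam (bind · lam (unit · (v₁ ∷ʳ v₀)) · (run-to ρ · π₁ v₁))
          $ (h₁ $ (use (every-init (Entry (Rel ρ))) ∙ v₄ ∙ v₁ ∙ v₀ $ h₀))
          $ (fold Λ Λ ƛ pack lam (v₂ ∷ʳ π₂ v₃ · v₀) ▹
            ⦅ conv refl (unfold (use (bind-extension (Value ρ) (Value (ρ *)) value-respects)) ∙ v₆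
              ∙ lam (v₂ ∷ʳ π₂ v₃ · v₀)
                ∙ π₂ v₂ ∙ (run-to ρ · π₁ v₂) ∙ lam (unit · (v₂ ∷ʳ v₀))
                $ (unfold (use (runs ρ l)) ∙ v₆ ∙ π₂ v₂ ∙ π₁ v₂
                $ unfold (use (every-last (Entry (Rel ρ))) ∙ v₆ ∙ v₃ ∙ v₂ $ h₁))
                $ (fold Λ Λ ƛ pack lam (v₄ ∷ʳ v₂) ▹
                  ⦅ conv refl (use (constant-rel (ρ *)) ∙ v₈ ∙ (v₃ ∷ʳ v₁))
                  , Λ ƛ conv refl (congr (v₅ ∷ʳ v₀) (symm (unfold h₁ ∙ v₀ $ h₀))) ⦆))
            , Λ ƛ conv refl (congr (v₀ ∷ʳ π₂ v₄ · v₁) (symm (unfold h₁ ∙ v₀ $ h₀))) ⦆))))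
      (conv refl (unfold (use (bind-extension (ListValue (Rel ρ)) (Value (ρ *)) value-respects)) ∙ v₂
        ∙ v₁ ∙ v₁ ∙ v₀ ∙ collect ρ
        $ h₁ $ (fold Λ Λ ƛ unpack unfold h₀ then pack lam (evaluate · v₀ · v₁) ▹
          ⦅ conv refl (replace (pred (Base (Value (ρ *)))
            (collect ρ · v₀ ∷ lam (evaluate · v₀ · v₂) ∷ v₆ ∷ []))
              (symm (∧-fst (∧-snd h₀))) (conv refl (h₂ ∙ v₀ $ ∧-fst h₀)))
          , Λ ƛ conv refl (symm (∧-snd (∧-snd h₁) ∙ v₀ $ h₀)) ⦆))))

    embed : (ρ : Ty) → Exp [] (ρ ⇒ ⟦ ρ ⟧)

    embed-in : (ρ : Ty) → Exp Γ (ρ ⇒ ⟦ ρ ⟧)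
    embed-in ρ = con (tm (embed ρ))

    entries : (ρ : Ty) → Exp Γ (ρ * ⇒ Entries ρ)
    entries ρ = kon srec · kon nil · lam (lam (lam (v₀ ∷ʳ ⟪ embed-in ρ · v₁ , lam v₂ ⟫)))

    embed N       = unit
    embed (ρ ⇒ η) = lam (lam (extend-to η · lam (embed-in η · (v₂ · v₀)) · (run-to ρ · v₀)))
    embed (ρ ⊗ η) = lam ⟪ embed-in ρ · π₁ v₀ , embed-in η · π₂ v₀ ⟫
    embed (ρ *)   = lam (unit · (representatives · (entries ρ · v₀)))

    Embeds : (ρ : Ty) → Form (ρ ⇒ ⟦ ρ ⟧ ∷ [])
    Embeds ρ = all Op (all ρ (pred (Rel ρ) (v₂ · v₀ ∷ lam v₁ ∷ v₁ ∷ [])))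

    -- The argument of a function of level at most 1 has level 0. Hence `run` delivers its plain
    -- value, the function is applied to it, and the result is embedded in turn.
    embeds : (ρ : Ty) → level ρ ≤ 1 → Γ ∣ Θ ⊨ pred (Embeds ρ) (embed-in ρ ∷ [])
    embeds N l = replace (pred (Embeds N) (v₀ ∷ [])) (symm (unfold-con (embed N)))
      (fold use (constant-rel N))
    embeds (ρ ⇒ η) l = replace (pred (Embeds (ρ ⇒ η)) (v₀ ∷ [])) (symm (unfold-con (embed (ρ ⇒ η))))
      (fold Λ Λ fold Λ Λ ƛ conv refl
      (unfold (use (extend-extension (Value ρ) η)) ∙ v₃ ∙ lam (v₃ · (v₁ · v₀)) ∙ v₀ ∙ (run-to ρ · v₁)
        ∙ lam (embed-in η · (v₃ · v₀))
        $ (unfold (use (runs ρ (s≤s⁻¹ (≤-trans (m≤m⊔n (suc (level ρ)) (level η)) l)))) ∙ v₃ ∙ v₀ ∙ v₁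
        $ h₀)
        $ (fold Λ Λ ƛ pack lam (v₅ · v₂) ▹
          ⦅ conv refl (unfold (use (embeds η (≤-trans (m≤n⊔m (suc (level ρ)) (level η)) l))) ∙ v₅
            ∙ (v₄ · v₁))
          , Λ ƛ conv refl (congr (v₆ · v₀) (symm (unfold h₁ ∙ v₀ $ h₀))) ⦆)))
    embeds (ρ ⊗ η) l = replace (pred (Embeds (ρ ⊗ η)) (v₀ ∷ [])) (symm (unfold-con (embed (ρ ⊗ η))))
      (fold Λ Λ fold
      ⦅ conv refl (unfold (use (embeds ρ (≤-trans (m≤m⊔n (level ρ) (level η)) l))) ∙ v₁ ∙ π₁ v₀)
      , conv refl (unfold (use (embeds η (≤-trans (m≤n⊔m (level ρ) (level η)) l))) ∙ v₁ ∙ π₂ v₀) ⦆)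
    embeds (ρ *) l = replace (pred (Embeds (ρ *)) (v₀ ∷ [])) (symm (unfold-con (embed (ρ *)))) (fold Λ Λ
      cut (list-induction (pred (Every (Entry (Rel ρ))) (entries ρ · v₀ ∷ v₂ ∷ []))
        (conv refl (use (every-nil (Entry (Rel ρ))) ∙ v₁))
        (Λ Λ ƛ conv refl (use (every-snoc (Entry (Rel ρ))) ∙ v₃ ∙ (entries ρ · v₁)
          ∙ ⟪ embed-in ρ · v₀ , lam v₁ ⟫
          $ h₀ $ (fold conv refl (unfold (use (embeds ρ l)) ∙ v₃ ∙ v₀)))))
      -- `list-rel` relates the embedded list to its evaluation at s, which this second induction
      -- identifies with the given list, independently of s.
      (cut (list-induction (all W (evaluate · v₀ · (entries ρ · v₁) ≐ v₁))
        (Λ compute) (Λ Λ ƛ Λ conv refl (congr (v₀ ∷ʳ v₂) (h₀ ∙ v₀))))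
      (conv refl (replaced {t = lam (evaluate · v₀ · (entries ρ · v₁))} {u = lam v₁}
        (pred (Rel (ρ *)) (unit · (representatives · (entries ρ · v₁)) ∷ v₀ ∷ v₂ ∷ []))
        (extensionality (conv refl (h₀ ∙ v₁ ∙ v₀)))
        (use (list-rel ρ) ∙ v₁ ∙ (entries ρ · v₀) $ (h₁ ∙ v₀)) refl))))

    -- query Φ n stands for the value at n of an unknown sequence; it extends the
    -- given finite sequence until it has the entry n.
    query : Exp Γ (Op ⇒ N ⇒ M τ)
    query = lam (lam (lam (iterateᵉ · v₂ · v₁ · lam (v₁ · (hatᵉ · v₀ · v₂) · v₀))))

    -- Once s has the entry n, all extensions share the value ŝ(n), so the candidate for this value
    -- is a fixed point at s. Locality and `hat-snoc` pass from it to the final functional of the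
    -- iteration, which reads the entry n anew at each s * x.
    query-rel : Γ ∣ Θ ⊨ all Op (all N (pred Local (v₁ ∷ []) ⊃
      pred (Base (Value τ)) (query · v₁ · v₀ ∷ lam (hatᵉ · v₀ · v₁) ∷ v₁ ∷ [])))
    query-rel = Λ Λ ƛ fold Λ Λ ƛ conv refl
      (use iterate-fixed ∙ v₃ ∙ v₂ ∙ lam (v₁ · (hatᵉ · v₀ · v₃) · v₀) ∙ v₁ $ h₁ $
        (ƛ (conv refl (h₁ ∙ v₁ ∙ (hatᵉ · v₁ · v₂) $ (use ⊇-refl ∙ v₁)
          $ (fold Λ ƛ conv refl (∧-snd (unfold h₀ ∙ v₃ $ h₁))))
          ⨾ (unfold h₂ ∙ (v₀ · (hatᵉ · v₁ · v₂)) ∙ lam (v₁ · (hatᵉ · v₀ · v₃) · v₀) ∙ v₁ $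
              (Λ conv refl (congr (v₂ · v₀ · (v₃ ∷ʳ v₁)) (symm (use hat-snoc ∙ v₂ ∙ v₀ ∙ v₃ $ h₀))))))))

    -- Both the index and the queried entry come as continuations, whence the two extensions.
    generic : Exp Γ (Op ⇒ ⟦ N ⇒ τ ⟧)
    generic = lam (lam (extend-to τ · lam (extend-to τ · embed-in τ · (query · v₂ · v₀)) · v₀))

    generic-rel : level τ ≤ 1 → Γ ∣ Θ ⊨ all Op (pred Local (v₀ ∷ []) ⊃
      pred (Rel (N ⇒ τ)) (generic · v₀ ∷ hatᵉ ∷ v₀ ∷ []))
    generic-rel l = Λ ƛ fold Λ Λ ƛ conv refl
      (unfold (use (extend-extension (Value N) τ)) ∙ v₂ ∙ lam (hatᵉ · v₀ · (v₁ · v₀)) ∙ v₀ ∙ v₁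
        ∙ lam (extend-to τ · embed-in τ · (query · v₃ · v₀)) $ h₀ $
          (fold Λ Λ ƛ pack lam (hatᵉ · v₀ · v₂) ▹
            ⦅ conv refl (unfold (use (extend-extension (Value τ) τ)) ∙ v₄ ∙ lam (hatᵉ · v₀ · v₂)
              ∙ lam (hatᵉ · v₀ · v₂)
                ∙ (query · v₄ · v₁) ∙ embed-in τ $ (use query-rel ∙ v₄ ∙ v₁ $ h₂) $
                (fold Λ Λ ƛ pack lam v₂ ▹
                  ⦅ conv refl (unfold (use (embeds τ l)) ∙ v₆ ∙ v₁)
                    , Λ ƛ conv refl (symm (unfold h₁ ∙ v₀ $ h₀)) ⦆))
            , Λ ƛ conv refl (congr (hatᵉ · v₁ · v₀) (symm (unfold h₁ ∙ v₀ $ h₀))) ⦆))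

    -- The bar recursor and its equation

    module Closure (l : level τ ≤ 1) (t : Tm [] ((N ⇒ τ) ⇒ N)) where

      -- Bar recursion is a fixed point of Φ = step G H.
      step : Exp Γ (Gᵗ τ σ ⇒ Hᵗ τ σ ⇒ Op)
      step = lam (lam (lam (lam (⌜ cond ⌝ · missing (con t · (hatᵉ · v₀)) v₀ · (v₃ · v₀)
        · (v₂ · v₀ · lam (v₂ · (v₁ ∷ʳ v₀)))))))

      t° : Comb [] ((N ⇒ τ) ⇒ N)
      t° = compile t

      -- The translated t is run on the generic sequence; the candidate for a value n prolongs s
      -- until |s| > n and then stops with G.
      ξ : Exp Γ (BRᵗ τ σ)
      ξ = lam (lam (con (tm (target t°)) · (generic · (step · v₁ · v₀)) · lam
        (iterateᵉ · (step · v₂ · v₁) · v₀ · v₂)))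

      -- The relation for t at the generic sequence leaves only the candidates to be checked, each
      -- where t(ŝ) equals its index. The hypothesis is discharged in `mainTheorem1` by
      -- `compile-correct`, which is about `Tm` and not about `Exp`.
      ξ-fixed : Γ ∣ Θ ⊨ con t ≐ con (source t°) ⊃ all (Gᵗ τ σ) (all (Hᵗ τ σ) (all W
        (ξ · v₂ · v₁ · v₀ ≐ step · v₂ · v₁ · (ξ · v₂ · v₁) · v₀)))
      ξ-fixed = ƛ Λ Λ Λ cut {ψ = pred Local (step · v₂ · v₁ ∷ [])}
        -- Φ uses its argument B only through λx. B(s * x), so extensionality gives locality.
        (fold Λ Λ Λ ƛ conv refl (congr (⌜ cond ⌝ · missing (con t · (hatᵉ · v₁)) v₁ · (v₆ · v₁) ·
          (v₅ · v₁ · v₀))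
          (extensional {f = lam (v₃ · (v₁ ∷ʳ v₀))} {g = lam (v₂ · (v₁ ∷ʳ v₀))}
            (conv refl (h₀ ∙ v₀)) refl)))
        (conv refl (unfold (unfold (use (represents t°) ∙ (step · v₂ · v₁))
          ∙ (generic · (step · v₂ · v₁)) ∙ hatᵉ
            $ (use (generic-rel l) ∙ (step · v₂ · v₁) $ h₀))
          ∙ v₀ ∙ lam (iterateᵉ · (step · v₃ · v₂) · v₀ · v₃)
          $ (Λ Λ ƛ ƛ conv refl (use iterate-fixed ∙ (step · v₄ · v₃) ∙ v₀ ∙ v₄ ∙ v₁ $ h₂ $
              -- Here s has the entry n and t(ŝ) = n, so the test in `step` is zero and Φ(G)(s) is
              -- G(s).
              (ƛ conv refl (congr (⌜ cond ⌝ · v₀ · (v₅ · v₂) · (v₄ · v₂ · lam (v₆ · (v₃ ∷ʳ v₀))))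
                (symm h₀ ⨾ congr (missing v₀ v₂)
                  (symm (congr (v₀ · (hatᵉ · v₂)) h₄
                    ⨾ conv refl (unfold h₁ ∙ v₁ $ (use ⊇-refl ∙ v₁)))))))))))

      -- Spelled out so that `fm` yields `spector-form` on the nose; what is left is to move a
      -- weakening past t and the zero object.
      Spector : Form []
      Spector = all (Gᵗ τ σ) (all (Hᵗ τ σ) (all W
        ( (ex N (⌜ plus ⌝ · s⁺ (con t · (hatᵉ · v₁)) · v₀ ≐ ⌜ len ⌝ · v₁) ⊃ con (tm ξ) · v₂ · v₁ · v₀
          ≐ v₂ · v₀)
        ∧ (ex N (⌜ plus ⌝ · (⌜ len ⌝ · v₁) · v₀ ≐ con t · (hatᵉ · v₁)) ⊃ con (tm ξ) · v₂ · v₁ · v₀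
            ≐ v₁ · v₀ · lam (con (tm ξ) · v₃ · v₂ · (v₁ ∷ʳ v₀))))))

      spector : [] ∣ [] ▸ con t ≐ con (source t°) ⊨ Spector
      spector = replace (all (Gᵗ τ σ) (all (Hᵗ τ σ) (all W
          ( (ex N (⌜ plus ⌝ · s⁺ (con t · (hatᵉ · v₁)) · v₀ ≐ ⌜ len ⌝ · v₁) ⊃ v₃ · v₂ · v₁ · v₀
            ≐ v₂ · v₀)
          ∧ (ex N (⌜ plus ⌝ · (⌜ len ⌝ · v₁) · v₀ ≐ con t · (hatᵉ · v₁)) ⊃ v₃ · v₂ · v₁ · v₀
              ≐ v₁ · v₀ · lam (v₄ · v₃ · v₂ · (v₁ ∷ʳ v₀)))))))
        (symm (unfold-con ξ))
        (cut (use ξ-fixed $ h₀) (Λ Λ Λ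
          ⦅ ƛ unpack h₀ then (h₂ ∙ v₃ ∙ v₂ ∙ v₁ ⨾ conv refl
              (congr (⌜ cond ⌝ · v₀ · (v₄ · v₂) · (v₃ · v₂ · lam (ξ · v₅ · v₄ · (v₃ ∷ʳ v₀))))
                (congr (monus (s⁺ (con t · (hatᵉ · v₂))) v₀) (symm h₀)
                  ⨾ use monus-plus ∙ s⁺ (con t · (hatᵉ · v₁)) ∙ v₀)))
          , ƛ unpack h₀ then (h₂ ∙ v₃ ∙ v₂ ∙ v₁ ⨾ conv refl
              (congr (⌜ cond ⌝ · v₀ · (v₄ · v₂) · (v₃ · v₂ · lam (ξ · v₅ · v₄ · (v₃ ∷ʳ v₀))))
                (congr (missing v₀ v₂) (symm h₀)
                  ⨾ use suc-plus-monus ∙ (⌜ len ⌝ · v₁) ∙ v₀))) ⦆))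

-- Transfer to the statement of the theorem

ren-0ᵗ : (r : Ren Γ Δ) (ρ : Ty) → ren r (0ᵗ ρ) ≡ 0ᵗ ρ
ren-0ᵗ r N       = refl
ren-0ᵗ r (ρ ⇒ η) = cong lam (ren-0ᵗ (liftR r) η)
ren-0ᵗ r (ρ ⊗ η) = cong₂ (λ a b → Pair · a · b) (ren-0ᵗ r ρ) (ren-0ᵗ r η)
ren-0ᵗ r (ρ *)   = refl

hat-from : Tm (N ∷ Γ) ρ → Tm Γ (ρ * ⇒ N ⇒ ρ)
hat-from z = SRec · lam z · lam (lam (lam (lam
  (cond · (dist · var Z · (len · var (S (S (S Z))))) · var (S (S Z)) · (var (S Z) · var Z)))))

-- SpectorBR τ σ t ξ, with the weakening of Y(ŝ) as a parameter.
spector-form : (τ σ : Ty) → Tm [] (BRᵗ τ σ) → Tm (N ∷ τ * ∷ Hᵗ τ σ ∷ Gᵗ τ σ ∷ []) N → Fm []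
spector-form τ σ ξ y = all (Gᵗ τ σ) (all (Hᵗ τ σ) (all (τ *)
  ( (ex N (plus · (Succ · y) · var Z ≐ len · var (S Z)) ⊃
      closed ξ · var (S (S Z)) · var (S Z) · var Z ≐ var (S (S Z)) · var Z)
  ∧ (ex N (plus · (len · var (S Z)) · var Z ≐ y) ⊃
      closed ξ · var (S (S Z)) · var (S Z) · var Z ≐
        var (S Z) · var Z · lam (closed ξ · var (S (S (S Z))) · var (S (S Z)) ·
          (Snoc · var (S Z) · var Z))))))

weakened-value : (τ σ : Ty) (t : Tm [] ((N ⇒ τ) ⇒ N)) →
  closed t · (hat-from (closed (0ᵗ τ)) · var (S Z))
    ≡ wk {Γ = τ * ∷ Hᵗ τ σ ∷ Gᵗ τ σ ∷ []} (closed t · (hat · var Z))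
weakened-value τ σ t = cong₂ (λ a z → a · (hat-from z · var (S Z)))
  (sym (ren-closed {Δ = N ∷ τ * ∷ Hᵗ τ σ ∷ Gᵗ τ σ ∷ []} S t)) (trans (ren-0ᵗ _ τ) (sym (ren-0ᵗ _ τ)))

mainTheorem1 : (τ σ : Ty) → level τ ≤ 1 → (t : Tm [] ((N ⇒ τ) ⇒ N)) →
    ∃[ ξ ] (HAω⊢ SpectorBR τ σ t ξ)
mainTheorem1 τ σ l t = tm (ξ {Γ = []}) ,
  subst (λ φ → [] ∣ [] ⊢ φ) (cong (spector-form τ σ (tm ξ)) (weakened-value τ σ t))
    (⊃E (⊃I (derivation (soundness spector)))
      (subst₂ (λ a b → [] ∣ [] ⊢ a ≐ b) (sym (closed-id t)) (sym (closed-id (source t°)))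
        (compile-correct t)))
  where open World.Recursion.Closure τ σ l t
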